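{- For every connected cograph $G$ of order $n\geq 1$, $$\frac{n}{2}< M_G\leq \frac{n+1}{2},$$ with equality in the upper bound if and only if $n=1$. Consequently, if $(G_i)_{i\ge 1}$ is any infinite sequence of distinct (pairwise non-isomorphic) connected cographs, and $n_i$ is the order of $G_i$, then the densities $M_{G_i}/n_i$ tend to $\tfrac12$ as $i\to\infty$.
   Context: All graphs are finite and simple with at least one vertex; the order of a graph is its number of vertices. A graph is a cograph if it contains no induced path on $4$ vertices. For a graph $G$ of order $n$, let $a_k(G)$ be the number of $k$-element vertex subsets of $G$ that induce a connected subgraph (single vertices count as connected), and let $\Phi_G(x)=\sum_{k=1}^n a_k(G)x^k$. The global mean of $G$ is $M_G=\Phi_G'(1)/\Phi_G(1)$, and the density of $G$ is $M_G/n$. -}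

module Defs where

open import Data.Fin.Base using (Fin; toℕ; fromℕ<)
open import Data.Fin.Properties using (all?; _≟_)
open import Data.Fin.Subset using (Subset; inside; outside; ∣_∣; ⁅_⁆) renaming (_∈_ to _∈ₛ_)
open import Data.Fin.Subset.Properties using (_∈?_; x∈⁅y⁆⇒x≡y; ∣⁅x⁆∣≡1)
import Data.Integer.Base as ℤ
open import Data.List.Base
  using (List; []; _∷_; _++_; map; filter; length; applyUpTo; zipWith; allFin)
open import Data.List.Membership.Propositional using (_∈_)
open import Data.List.Membership.Propositional.Properties
  using (∈-allFin; ∈-filter⁺; ∈-length; ∈-map⁺; ∈-++⁺ˡ; ∈-++⁺ʳ)
open import Data.List.Relation.Unary.Any using (here; there)
open import Data.Nat.Base as ℕ using (ℕ; zero; suc; _+_; _*_; NonZero)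
import Data.Nat.Properties as ℕ
open import Data.Product using (Σ-syntax; ∃-syntax; _×_; _,_)
open import Data.Rational.Base as ℚ using (ℚ; 0ℚ; _/_; _÷_)
import Data.Rational.Properties as ℚ
open import Data.Sum.Base as Sum using (_⊎_; inj₁; inj₂)
open import Data.Vec.Base using ([]; _∷_)
open import Function.Bundles using (_⇔_; _↔_; Inverse)
open import Function.Definitions using (Injective)
open import Level using (0ℓ)
open import Relation.Binary.Construct.Closure.ReflexiveTransitive using (Star; ε; _◅_; _◅◅_)
open import Relation.Binary.Core using (Rel)
open import Relation.Binary.Definitions using (Decidable; Irreflexive; Symmetric)
open import Relation.Binary.PropositionalEquality using (_≡_; refl; sym; trans; subst)
open import Relation.Nullary.Decidable using (Dec; map′; _×-dec_; _⊎-dec_; _→-dec_)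
open import Relation.Nullary.Negation using (¬_)

record Graph : Set₁ where
  field
    order   : ℕ
    nonZero : NonZero order

  Vertex : Set
  Vertex = Fin order

  field
    _~_    : Rel Vertex 0ℓ
    symm   : Symmetric _~_
    irrefl : Irreflexive _≡_ _~_
    _~?_   : Decidable _~_

  instance
    order-nonZero : NonZero order
    order-nonZero = nonZero

open Graph using (order; Vertex)

Connected : Graph → Set
Connected G = ∀ u v → Star _~_ u v
  where open Graph G

_≅_ : Graph → Graph → Set
G ≅ H = Σ[ f ∈ (Vertex G ↔ Vertex H) ]
          (∀ u v → (u G.~ v) ⇔ (Inverse.to f u H.~ Inverse.to f v))
  where module G = Graph G
        module H = Graph H

-- Some set of vertices of G induces a copy of H.
_InducedIn_ : Graph → Graph → Set
H InducedIn G = Σ[ f ∈ (Vertex H → Vertex G) ]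
                  Injective _≡_ _≡_ f × (∀ u v → (u H.~ v) ⇔ (f u G.~ f v))
  where module G = Graph G
        module H = Graph H

path : ∀ n .{{_ : NonZero n}} → Graph
path n@(suc _) = record
  { order   = n
  ; nonZero = _
  ; _~_     = λ i j → suc (toℕ i) ≡ toℕ j ⊎ suc (toℕ j) ≡ toℕ i
  ; symm    = Sum.swap
  ; irrefl  = λ { refl (inj₁ e) → ℕ.1+n≢n e ; refl (inj₂ e) → ℕ.1+n≢n e }
  ; _~?_    = λ i j → (suc (toℕ i) ℕ.≟ toℕ j) ⊎-dec (suc (toℕ j) ℕ.≟ toℕ i)
  }

Cograph : Graph → Set
Cograph G = ¬ (path 4 InducedIn G)

module _ {n} {_R_ : Rel (Fin n) 0ℓ} (_R?_ : Decidable _R_) where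

  private
    -- Floyd–Warshall: walks all of whose intermediate vertices lie in the list.
    Via : List (Fin n) → Rel (Fin n) 0ℓ
    Via []       u v = u ≡ v ⊎ u R v
    Via (x ∷ xs) u v = Via xs u v ⊎ (Via xs u x × Via xs x v)

    via? : ∀ xs → Decidable (Via xs)
    via? []       u v = (u ≟ v) ⊎-dec (u R? v)
    via? (x ∷ xs) u v = via? xs u v ⊎-dec (via? xs u x ×-dec via? xs x v)

    base : ∀ xs {u v} → u ≡ v ⊎ u R v → Via xs u v
    base []       p = p
    base (x ∷ xs) p = inj₁ (base xs p)

    via-trans : ∀ xs {u w v} → w ∈ xs → Via xs u w → Via xs w v → Via xs u v
    via-trans (x ∷ xs) (here refl) p q = inj₂ (fromL p , toR q)
      where
      fromL : ∀ {u} → Via (x ∷ xs) u x → Via xs u x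
      fromL (inj₁ a)       = a
      fromL (inj₂ (a , _)) = a
      toR : ∀ {v} → Via (x ∷ xs) x v → Via xs x v
      toR (inj₁ a)       = a
      toR (inj₂ (_ , a)) = a
    via-trans (x ∷ xs) (there m) (inj₁ a)       (inj₁ b)       = inj₁ (via-trans xs m a b)
    via-trans (x ∷ xs) (there m) (inj₁ a)       (inj₂ (b , c)) = inj₂ (via-trans xs m a b , c)
    via-trans (x ∷ xs) (there m) (inj₂ (a , b)) (inj₁ c)       = inj₂ (a , via-trans xs m b c)
    via-trans (x ∷ xs) (there m) (inj₂ (a , _)) (inj₂ (_ , d)) = inj₂ (a , d)

    sound : ∀ xs {u v} → Via xs u v → Star _R_ u v
    sound []       (inj₁ refl)    = ε
    sound []       (inj₂ r)       = r ◅ ε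
    sound (x ∷ xs) (inj₁ p)       = sound xs p
    sound (x ∷ xs) (inj₂ (p , q)) = sound xs p ◅◅ sound xs q

    complete : ∀ {u v} → Star _R_ u v → Via (allFin n) u v
    complete ε        = base (allFin n) (inj₁ refl)
    complete (r ◅ rs) =
      via-trans (allFin n) (∈-allFin _) (base (allFin n) (inj₂ r)) (complete rs)

  star? : Decidable (Star _R_)
  star? u v = map′ (sound (allFin n)) complete (via? (allFin n) u v)

-- All subsets of Fin n, each listed exactly once.
subsets : ∀ n → List (Subset n)
subsets zero    = [] ∷ []
subsets (suc n) = map (outside ∷_) (subsets n) ++ map (inside ∷_) (subsets n)

∈-subsets : ∀ {n} (S : Subset n) → S ∈ subsets n
∈-subsets []            = here refl
∈-subsets (outside ∷ S) = ∈-++⁺ˡ (∈-map⁺ (outside ∷_) (∈-subsets S))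
∈-subsets {suc n} (inside ∷ S) =
  ∈-++⁺ʳ (map (outside ∷_) (subsets n)) (∈-map⁺ (inside ∷_) (∈-subsets S))

module _ (G : Graph) where
  open Graph G hiding (order; Vertex)

  -- Adjacency in the subgraph induced by S; vertices outside S are isolated.
  InducedAdj : Subset (order G) → Rel (Vertex G) 0ℓ
  InducedAdj S u v = u ∈ₛ S × v ∈ₛ S × u ~ v

  InducesConnected : Subset (order G) → Set
  InducesConnected S = ∀ u v → u ∈ₛ S → v ∈ₛ S → Star (InducedAdj S) u v

  inducesConnected? : ∀ S → Dec (InducesConnected S)
  inducesConnected? S = all? λ u → all? λ v →
    (u ∈? S) →-dec ((v ∈? S) →-dec
      star? (λ x y → (x ∈? S) ×-dec ((y ∈? S) ×-dec (x ~? y))) u v)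

  a : ℕ → ℕ
  a k = length (filter (λ S → (∣ S ∣ ℕ.≟ k) ×-dec inducesConnected? S) (subsets (order G)))

-- Coefficient lists, constant coefficient first.
Poly : Set
Poly = List ℕ

eval : Poly → ℕ → ℕ
eval []      x = 0
eval (c ∷ p) x = c + x * eval p x

deriv : Poly → Poly
deriv []      = []
deriv (_ ∷ p) = zipWith _*_ (applyUpTo suc (length p)) p

Φ : Graph → Poly
Φ G = 0 ∷ applyUpTo (λ i → a G (suc i)) (order G)

-- Single vertices induce connected subgraphs, so the division below is legitimate.
Φ[1]-nonZero : ∀ G → NonZero (eval (Φ G) 1)
Φ[1]-nonZero G = go (order G) (Graph.nonZero G)
  where
  v₀ : Vertex G
  v₀ = fromℕ< (ℕ.>-nonZero⁻¹ (order G) {{Graph.nonZero G}})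

  connected : InducesConnected G ⁅ v₀ ⁆
  connected u v u∈ v∈ =
    subst (Star _ u) (trans (x∈⁅y⁆⇒x≡y v₀ u∈) (sym (x∈⁅y⁆⇒x≡y v₀ v∈))) ε

  a₁>0 : 0 ℕ.< a G 1
  a₁>0 = ∈-length (∈-filter⁺ (λ S → (∣ S ∣ ℕ.≟ 1) ×-dec inducesConnected? G S)
                             (∈-subsets ⁅ v₀ ⁆) (∣⁅x⁆∣≡1 v₀ , connected))

  go : ∀ m → NonZero m → NonZero (eval (0 ∷ applyUpTo (λ i → a G (suc i)) m) 1)
  go (suc m) _ = ℕ.>-nonZero
    (ℕ.<-≤-trans a₁>0 (ℕ.≤-trans (ℕ.m≤m+n (a G 1) _) (ℕ.m≤m+n _ 0)))

M : Graph → ℚ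
M G = _/_ (ℤ.+ eval (deriv (Φ G)) 1) (eval (Φ G) 1) {{Φ[1]-nonZero G}}

density : Graph → ℚ
density G = _÷_ (M G) (ℤ.+ order G / 1) {{order≢0}}
  where
  order≢0 : ℚ.NonZero (ℤ.+ order G / 1)
  order≢0 = ℚ.pos⇒nonZero (ℤ.+ order G / 1) {{ℚ.normalize-pos (order G) 1 {{_}} {{Graph.nonZero G}}}}

-- Every positive real exceeds some positive rational, so rational ε suffice.
_⟶_ : (ℕ → ℚ) → ℚ → Set
x ⟶ L = ∀ ε → 0ℚ ℚ.< ε → ∃[ N ] (∀ i → N ℕ.≤ i → ℚ.∣ x i ℚ.- L ∣ ℚ.< ε)

{-# OPTIONS --safe #-}

-- A cograph on W with at least two vertices splits into X and Y with either no
-- edge or every edge between them, so a subset of W meeting both X and Y is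
-- respectively always disconnected or always connected.  Write w, x, y for the
-- orders, and c and s for the number and the total size of the connected sets
-- with at least two vertices.  Induction along the splitting gives
--   2s + 1 ≤ (w + 1) c + w   and   2s ≤ (w + 2) c,
-- the join case of the first resting on (2^x - 1 - x)(2^y - 1 - y) ≥ (x - 1)(y - 1).
-- The argument is symmetric under complementing the graph, so the same holds for
-- disconnected sets.  The first bound gives the upper bound on M_G.  For a connected
-- graph, the disconnected sets live in X or in Y; adding their two bounds and
-- subtracting from the sums over all subsets gives the lower bound.  Finally,
-- n/2 < M_G ≤ (n + 1)/2 puts the density within 1/(2n) of 1/2, and there are only
-- finitely many graphs of each order.

module Submission where

open import Defs
open import Axiom.ExcludedMiddle using (ExcludedMiddle)
open import Data.Bool.Base using (Bool; true; false; not; if_then_else_; _∧_)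
open import Data.Bool.Properties using (not-involutive; not-injective; ¬-not) renaming (_≟_ to _≟ᵇ_)
open import Data.Empty using (⊥; ⊥-elim)
open import Data.Fin.Base using (Fin; zero; suc; fromℕ<; funToFin; finToFun)
open import Data.Fin.Properties using (_≟_; all?; finToFun-funToFin; 2↔Bool)
open import Data.Fin.Subset using (Subset; inside; outside; ∣_∣; _∪_; _∩_; ∁; _⊆_; Nonempty; ⁅_⁆)
  renaming (⊥ to ∅; ⊤ to full; _∈_ to _∈ₛ_)
open import Data.Fin.Subset.Properties
import Data.Integer.Base as ℤ
import Data.Integer.Properties as ℤ
open import Data.List.Base
  using (List; []; _∷_; _++_; map; filter; length; applyUpTo; zipWith; allFin)
open import Data.List.Membership.Propositional using (_∈_; find)
open import Data.List.Membership.Propositional.Properties using (∈-allFin; ∈-filter⁺; ∈-filter⁻)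
import Data.List.Membership.DecPropositional as DecMembership
open import Data.List.Properties using (length-applyUpTo; map-++; map-∘)
import Data.List.Relation.Unary.All as All
open import Data.List.Relation.Unary.Any using (here; there)
open import Data.Nat.Base as ℕ using (ℕ; zero; suc; _+_; _*_; _^_; _⊔_; z≤n; s≤s; NonZero)
open import Data.Nat.Induction using (Acc; acc; <-wellFounded)
open import Data.Nat.ListAction using (sum)
open import Data.Nat.ListAction.Properties using (sum-++)
open import Data.Nat.Properties hiding (_≟_)
import Data.Nat.Properties as ℕ
open import Algebra.Properties.CommutativeSemigroup +-commutativeSemigroup using (interchange)
open import Data.Nat.Tactic.RingSolver using (solve-∀)
open import Data.Product using (Σ-syntax; ∃-syntax; _×_; _,_; proj₁; proj₂)
open import Data.Rational.Base using (ℚ; mkℚ; _/_; _<_; _≤_; ½; 0ℚ; 1/_; Positive; *<*; toℚᵘ; ↧ₙ_)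
import Data.Rational.Base as ℚ
import Data.Rational.Properties as ℚ
open import Data.Rational.Unnormalised.Base as ℚᵘ using (mkℚᵘ; *≡*)
import Data.Rational.Unnormalised.Properties as ℚᵘ
open import Data.Sum.Base using (_⊎_; inj₁; inj₂)
open import Data.Vec.Base using ([]; _∷_; here; there; tabulate)
open import Data.Vec.Properties using (lookup∘tabulate; lookup⇒[]=; []=⇒lookup)
open import Function.Base using (_∘_; id; case_of_)
open import Function.Bundles using (_⇔_; mk⇔; Inverse)
open import Function.Construct.Identity using (↔-id)
open import Level using (0ℓ)
import Relation.Binary.Construct.Closure.ReflexiveTransitive as Star
open Star using (Star; _◅_)
open import Relation.Binary.PropositionalEquality
  using (_≡_; _≢_; refl; sym; trans; cong; cong₂; subst; subst₂; module ≡-Reasoning)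
open import Relation.Nullary.Decidable
  using (Dec; yes; no; does; dec-true; dec-false; toWitness; _×-dec_; _→-dec_)
open import Relation.Nullary.Negation using (¬_; contradiction)
open import Relation.Unary using (Pred; Decidable)

-- Sums over the subsets of a set of vertices

Σ⊆ : ∀ {n} → Subset n → (Subset n → ℕ) → ℕ
Σ⊆ []            f = f []
Σ⊆ (outside ∷ W) f = Σ⊆ W (f ∘ (outside ∷_))
Σ⊆ (inside  ∷ W) f = Σ⊆ W (f ∘ (outside ∷_)) + Σ⊆ W (f ∘ (inside ∷_))

-- The sum over the nonempty subsets of `W`. Once the first vertex is chosen the rest is
-- unrestricted, hence `Σ⊆` in the last clause.
Σ⁺ : ∀ {n} → Subset n → (Subset n → ℕ) → ℕ
Σ⁺ []            f = 0
Σ⁺ (outside ∷ W) f = Σ⁺ W (f ∘ (outside ∷_))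
Σ⁺ (inside  ∷ W) f = Σ⁺ W (f ∘ (outside ∷_)) + Σ⊆ W (f ∘ (inside ∷_))

Σ⊆-cong : ∀ {n} (W : Subset n) {f g} → (∀ S → S ⊆ W → f S ≡ g S) → Σ⊆ W f ≡ Σ⊆ W g
Σ⊆-cong []            f≗g = f≗g [] λ x∈ → x∈
Σ⊆-cong (outside ∷ W) f≗g = Σ⊆-cong W λ S S⊆W → f≗g _ (out⊆ S⊆W)
Σ⊆-cong (inside  ∷ W) f≗g = cong₂ _+_
  (Σ⊆-cong W λ S S⊆W → f≗g _ (out⊆ S⊆W))
  (Σ⊆-cong W λ S S⊆W → f≗g _ (s⊆s S⊆W))

Σ⁺-cong : ∀ {n} (W : Subset n) {f g} →
          (∀ S → Nonempty S → S ⊆ W → f S ≡ g S) → Σ⁺ W f ≡ Σ⁺ W g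
Σ⁺-cong []            f≗g = refl
Σ⁺-cong (outside ∷ W) f≗g =
  Σ⁺-cong W λ { S (x , x∈S) S⊆W → f≗g _ (suc x , there x∈S) (out⊆ S⊆W) }
Σ⁺-cong (inside  ∷ W) f≗g = cong₂ _+_
  (Σ⁺-cong W λ { S (x , x∈S) S⊆W → f≗g _ (suc x , there x∈S) (out⊆ S⊆W) })
  (Σ⊆-cong W λ S S⊆W → f≗g _ (zero , here) (s⊆s S⊆W))

Σ⊆-+ : ∀ {n} (W : Subset n) f g → Σ⊆ W (λ S → f S + g S) ≡ Σ⊆ W f + Σ⊆ W g
Σ⊆-+ []            f g = refl
Σ⊆-+ (outside ∷ W) f g = Σ⊆-+ W _ _
Σ⊆-+ (inside  ∷ W) f g =
  trans (cong₂ _+_ (Σ⊆-+ W _ _) (Σ⊆-+ W _ _))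
        (interchange (Σ⊆ W _) (Σ⊆ W _) (Σ⊆ W _) (Σ⊆ W _))

Σ⁺-+ : ∀ {n} (W : Subset n) f g → Σ⁺ W (λ S → f S + g S) ≡ Σ⁺ W f + Σ⁺ W g
Σ⁺-+ []            f g = refl
Σ⁺-+ (outside ∷ W) f g = Σ⁺-+ W _ _
Σ⁺-+ (inside  ∷ W) f g =
  trans (cong₂ _+_ (Σ⁺-+ W _ _) (Σ⊆-+ W _ _))
        (interchange (Σ⁺ W _) (Σ⁺ W _) (Σ⊆ W _) (Σ⊆ W _))

Σ⁺-zero : ∀ {n} (W : Subset n) → Σ⁺ W (λ _ → 0) ≡ 0
Σ⁺-zero W = +-cancelˡ-≡ (Σ⁺ W (λ _ → 0)) _ _
  (trans (sym (Σ⁺-+ W (λ _ → 0) (λ _ → 0))) (sym (+-identityʳ _)))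

Σ⊆-∅+Σ⁺ : ∀ {n} (W : Subset n) f → Σ⊆ W f ≡ f ∅ + Σ⁺ W f
Σ⊆-∅+Σ⁺ []            f = sym (+-identityʳ _)
Σ⊆-∅+Σ⁺ (outside ∷ W) f = Σ⊆-∅+Σ⁺ W _
Σ⊆-∅+Σ⁺ (inside  ∷ W) f =
  trans (cong₂ _+_ (Σ⊆-∅+Σ⁺ W _) refl) (+-assoc (f ∅) _ _)

-- A subset of `W` is in exactly one way a subset of `W ∩ c` together with a subset of `W ∩ ∁ c`.
Σ⊆-split : ∀ {n} (W c : Subset n) f →
           Σ⊆ W f ≡ Σ⊆ (W ∩ c) (λ S → Σ⊆ (W ∩ ∁ c) (λ T → f (S ∪ T)))
Σ⊆-split []            []            f = refl
Σ⊆-split (outside ∷ W) (_       ∷ c) f = Σ⊆-split W c _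
Σ⊆-split (inside  ∷ W) (inside  ∷ c) f = cong₂ _+_ (Σ⊆-split W c _) (Σ⊆-split W c _)
Σ⊆-split (inside  ∷ W) (outside ∷ c) f =
  trans (cong₂ _+_ (Σ⊆-split W c _) (Σ⊆-split W c _)) (sym (Σ⊆-+ (W ∩ c) _ _))

-- A nonempty subset of `W` lies in `W ∩ c`, lies in `W ∩ ∁ c`, or meets both. This follows from
-- `Σ⊆-split` by splitting off the empty set in each factor and cancelling `f ∅`.
Σ⁺-split : ∀ {n} (W c : Subset n) f →
           Σ⁺ W f ≡ Σ⁺ (W ∩ c) f + Σ⁺ (W ∩ ∁ c) f
                    + Σ⁺ (W ∩ c) (λ S → Σ⁺ (W ∩ ∁ c) (λ T → f (S ∪ T)))
Σ⁺-split W c f = +-cancelˡ-≡ (f ∅) _ _ (begin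
  f ∅ + Σ⁺ W f
    ≡⟨ Σ⊆-∅+Σ⁺ W f ⟨
  Σ⊆ W f
    ≡⟨ Σ⊆-split W c f ⟩
  Σ⊆ X (λ S → Σ⊆ Y (λ T → f (S ∪ T)))
    ≡⟨ Σ⊆-∅+Σ⁺ X _ ⟩
  Σ⊆ Y (λ T → f (∅ ∪ T)) + Σ⁺ X (λ S → Σ⊆ Y (λ T → f (S ∪ T)))
    ≡⟨ cong₂ _+_ (Σ⊆-cong Y λ T _ → cong f (∪-identityˡ T))
                 (Σ⁺-cong X λ S _ _ → trans (Σ⊆-∅+Σ⁺ Y _)
                   (cong₂ _+_ (cong f (∪-identityʳ S)) refl)) ⟩
  Σ⊆ Y f + Σ⁺ X (λ S → f S + Σ⁺ Y (λ T → f (S ∪ T)))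
    ≡⟨ cong₂ _+_ (Σ⊆-∅+Σ⁺ Y f) (Σ⁺-+ X f _) ⟩
  f ∅ + Σ⁺ Y f + (Σ⁺ X f + Σ⁺ X (λ S → Σ⁺ Y (λ T → f (S ∪ T))))
    ≡⟨ rearrange (f ∅) (Σ⁺ Y f) (Σ⁺ X f) _ ⟩
  f ∅ + (Σ⁺ X f + Σ⁺ Y f + Σ⁺ X (λ S → Σ⁺ Y (λ T → f (S ∪ T)))) ∎)
  where
  open ≡-Reasoning
  X = W ∩ c
  Y = W ∩ ∁ c
  rearrange : ∀ e y x z → e + y + (x + z) ≡ e + (x + y + z)
  rearrange = solve-∀

∣W∩c∣+∣W∩∁c∣≡∣W∣ : ∀ {n} (W c : Subset n) → ∣ W ∩ c ∣ + ∣ W ∩ ∁ c ∣ ≡ ∣ W ∣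
∣W∩c∣+∣W∩∁c∣≡∣W∣ []            []            = refl
∣W∩c∣+∣W∩∁c∣≡∣W∣ (outside ∷ W) (_       ∷ c) = ∣W∩c∣+∣W∩∁c∣≡∣W∣ W c
∣W∩c∣+∣W∩∁c∣≡∣W∣ (inside  ∷ W) (inside  ∷ c) = cong suc (∣W∩c∣+∣W∩∁c∣≡∣W∣ W c)
∣W∩c∣+∣W∩∁c∣≡∣W∣ (inside  ∷ W) (outside ∷ c) =
  trans (+-suc ∣ W ∩ c ∣ _) (cong suc (∣W∩c∣+∣W∩∁c∣≡∣W∣ W c))

Σ⊆-one : ∀ {n} (W : Subset n) → Σ⊆ W (λ _ → 1) ≡ 2 ^ ∣ W ∣
Σ⊆-one []            = refl
Σ⊆-one (outside ∷ W) = Σ⊆-one W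
Σ⊆-one (inside  ∷ W) = cong₂ _+_ (Σ⊆-one W) (trans (Σ⊆-one W) (sym (+-identityʳ _)))

-- Pairing a subset with its complement in `W` shows that the average size is half of `∣ W ∣`. The
-- factor 2 avoids division.
2*Σ⊆-∣∣ : ∀ {n} (W : Subset n) → 2 * Σ⊆ W ∣_∣ ≡ ∣ W ∣ * 2 ^ ∣ W ∣
2*Σ⊆-∣∣ []            = refl
2*Σ⊆-∣∣ (outside ∷ W) = 2*Σ⊆-∣∣ W
2*Σ⊆-∣∣ (inside  ∷ W) = begin
  2 * (σ + Σ⊆ W (λ S → 1 + ∣ S ∣))  ≡⟨ cong (λ k → 2 * (σ + k)) (Σ⊆-+ W (λ _ → 1) ∣_∣) ⟩
  2 * (σ + (Σ⊆ W (λ _ → 1) + σ))    ≡⟨ cong (λ k → 2 * (σ + (k + σ))) (Σ⊆-one W) ⟩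
  2 * (σ + (2 ^ ∣ W ∣ + σ))         ≡⟨ double σ (2 ^ ∣ W ∣) ⟩
  2 * 2 ^ ∣ W ∣ + 2 * (2 * σ)       ≡⟨ cong (λ k → 2 * 2 ^ ∣ W ∣ + 2 * k) (2*Σ⊆-∣∣ W) ⟩
  2 * 2 ^ ∣ W ∣ + 2 * (∣ W ∣ * 2 ^ ∣ W ∣)
    ≡⟨ factor (2 ^ ∣ W ∣) ∣ W ∣ ⟩
  suc ∣ W ∣ * (2 * 2 ^ ∣ W ∣)       ∎
  where
  open ≡-Reasoning
  σ = Σ⊆ W ∣_∣
  double : ∀ s e → 2 * (s + (e + s)) ≡ 2 * e + 2 * (2 * s)
  double = solve-∀
  factor : ∀ e w → 2 * e + 2 * (w * e) ≡ suc w * (2 * e)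
  factor = solve-∀

suc-Σ⁺-one : ∀ {n} (W : Subset n) → suc (Σ⁺ W (λ _ → 1)) ≡ 2 ^ ∣ W ∣
suc-Σ⁺-one W = trans (sym (Σ⊆-∅+Σ⁺ W _)) (Σ⊆-one W)

2*Σ⁺-∣∣ : ∀ {n} (W : Subset n) → 2 * Σ⁺ W ∣_∣ ≡ ∣ W ∣ * suc (Σ⁺ W (λ _ → 1))
2*Σ⁺-∣∣ {n} W = begin
  2 * Σ⁺ W ∣_∣                 ≡⟨ cong (λ k → 2 * (k + Σ⁺ W ∣_∣)) (∣⊥∣≡0 n) ⟨
  2 * (∣ ∅ {n} ∣ + Σ⁺ W ∣_∣)   ≡⟨ cong (2 *_) (Σ⊆-∅+Σ⁺ W ∣_∣) ⟨
  2 * Σ⊆ W ∣_∣                 ≡⟨ 2*Σ⊆-∣∣ W ⟩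
  ∣ W ∣ * 2 ^ ∣ W ∣            ≡⟨ cong (∣ W ∣ *_) (suc-Σ⁺-one W) ⟨
  ∣ W ∣ * suc (Σ⁺ W (λ _ → 1)) ∎
  where open ≡-Reasoning

module _ {n} (W c : Subset n) where
  private
    X = W ∩ c
    Y = W ∩ ∁ c
    x = ∣ X ∣
    y = ∣ Y ∣
    u = Σ⁺ X (λ _ → 1)
    v = Σ⁺ Y (λ _ → 1)

  -- With `suc u` and `suc v` equal to 2^x and 2^y, comparing 2^(x+y) with their product isolates
  -- the pairs of nonempty parts.
  Σ⁺-both-one : Σ⁺ X (λ _ → Σ⁺ Y (λ _ → 1)) ≡ u * v
  Σ⁺-both-one = +-cancelˡ-≡ (suc (u + v)) _ _ (begin
    suc (u + v) + Σ⁺ X (λ _ → v)  ≡⟨ cong suc (Σ⁺-split W c (λ _ → 1)) ⟨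
    suc (Σ⁺ W (λ _ → 1))          ≡⟨ suc-Σ⁺-one W ⟩
    2 ^ ∣ W ∣                     ≡⟨ cong (2 ^_) (∣W∩c∣+∣W∩∁c∣≡∣W∣ W c) ⟨
    2 ^ (x + y)                   ≡⟨ ^-distribˡ-+-* 2 x y ⟩
    2 ^ x * 2 ^ y                 ≡⟨ cong₂ _*_ (suc-Σ⁺-one X) (suc-Σ⁺-one Y) ⟨
    suc u * suc v                 ≡⟨ expand u v ⟩
    suc (u + v) + u * v           ∎)
    where
    open ≡-Reasoning
    expand : ∀ u v → suc u * suc v ≡ suc (u + v) + u * v
    expand = solve-∀

  -- The total over `W` minus the totals over `X` and over `Y`. The correction `x * v + y * u`
  -- arises because leaving out the empty part raises the average size on each side.
  2*Σ⁺-both-∣∣ : 2 * Σ⁺ X (λ S → Σ⁺ Y (λ T → ∣ S ∪ T ∣)) ≡ (x + y) * (u * v) + (x * v + y * u)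
  2*Σ⁺-both-∣∣ = +-cancelˡ-≡ (x * suc u + y * suc v) _ _ (begin
    x * suc u + y * suc v + 2 * σ  ≡⟨ cong (_+ 2 * σ) (cong₂ _+_ (2*Σ⁺-∣∣ X) (2*Σ⁺-∣∣ Y)) ⟨
    2 * Σ⁺ X ∣_∣ + 2 * Σ⁺ Y ∣_∣ + 2 * σ
      ≡⟨ collect (Σ⁺ X ∣_∣) (Σ⁺ Y ∣_∣) σ ⟩
    2 * (Σ⁺ X ∣_∣ + Σ⁺ Y ∣_∣ + σ)  ≡⟨ cong (2 *_) (Σ⁺-split W c ∣_∣) ⟨
    2 * Σ⁺ W ∣_∣                   ≡⟨ 2*Σ⁺-∣∣ W ⟩
    ∣ W ∣ * suc (Σ⁺ W (λ _ → 1))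
      ≡⟨ cong₂ (λ k l → k * suc l) (sym (∣W∩c∣+∣W∩∁c∣≡∣W∣ W c)) (Σ⁺-split W c (λ _ → 1)) ⟩
    (x + y) * suc (u + v + Σ⁺ X (λ _ → v))
      ≡⟨ cong (λ k → (x + y) * suc (u + v + k)) Σ⁺-both-one ⟩
    (x + y) * suc (u + v + u * v)  ≡⟨ expand x y u v ⟩
    x * suc u + y * suc v + ((x + y) * (u * v) + (x * v + y * u)) ∎)
    where
    open ≡-Reasoning
    σ = Σ⁺ X (λ S → Σ⁺ Y (λ T → ∣ S ∪ T ∣))
    collect : ∀ a b c → 2 * a + 2 * b + 2 * c ≡ 2 * (a + b + c)
    collect = solve-∀
    expand : ∀ x y u v → (x + y) * suc (u + v + u * v)
                       ≡ x * suc u + y * suc v + ((x + y) * (u * v) + (x * v + y * u))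
    expand = solve-∀

-- Bounds from a cotree

module _ {n} (χ : Subset n → Bool) where

  weight : (Subset n → ℕ) → Subset n → ℕ
  weight g W = Σ⁺ W (λ S → if χ S then g S else 0)

  count size : Subset n → ℕ
  count = weight (λ _ → 1)
  size  = weight ∣_∣

  -- When χ S says that S is connected, b is true at a join and false at a disjoint
  -- union, and ℓ, the value of χ on singletons, is true; not ∘ χ flips b and ℓ.
  data Cotree (ℓ : Bool) : Subset n → Set where
    leaf : ∀ {W} → ∣ W ∣ ≡ 1 → (∀ S → Nonempty S → S ⊆ W → χ S ≡ ℓ) → Cotree ℓ W
    node : ∀ {W} c b → Nonempty (W ∩ c) → Nonempty (W ∩ ∁ c) →
           (∀ S T → Nonempty S → S ⊆ W ∩ c → Nonempty T → T ⊆ W ∩ ∁ c → χ (S ∪ T) ≡ b) →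
           Cotree ℓ (W ∩ c) → Cotree ℓ (W ∩ ∁ c) → Cotree ℓ W

  weight-leaf : ∀ {W ℓ} g → (∀ S → Nonempty S → S ⊆ W → χ S ≡ ℓ) →
                weight g W ≡ (if ℓ then Σ⁺ W g else 0)
  weight-leaf {W} {true}  g χ≡ℓ =
    Σ⁺-cong W λ S S≢∅ S⊆W → cong (if_then g S else 0) (χ≡ℓ S S≢∅ S⊆W)
  weight-leaf {W} {false} g χ≡ℓ = trans
    (Σ⁺-cong W λ S S≢∅ S⊆W → cong (if_then g S else 0) (χ≡ℓ S S≢∅ S⊆W)) (Σ⁺-zero W)

  -- All sets meeting both sides share the value `b`, so they contribute either all of their weight
  -- or nothing.
  weight-node : ∀ {W} c b →
    (∀ S T → Nonempty S → S ⊆ W ∩ c → Nonempty T → T ⊆ W ∩ ∁ c → χ (S ∪ T) ≡ b) →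
    ∀ g → weight g W ≡ weight g (W ∩ c) + weight g (W ∩ ∁ c)
            + (if b then Σ⁺ (W ∩ c) (λ S → Σ⁺ (W ∩ ∁ c) (λ T → g (S ∪ T))) else 0)
  weight-node {W} c b χ≡b g = trans (Σ⁺-split W c _) (cong₂ _+_ refl (both b χ≡b))
    where
    both : ∀ b →
      (∀ S T → Nonempty S → S ⊆ W ∩ c → Nonempty T → T ⊆ W ∩ ∁ c → χ (S ∪ T) ≡ b) →
      Σ⁺ (W ∩ c) (λ S → Σ⁺ (W ∩ ∁ c) (λ T → if χ (S ∪ T) then g (S ∪ T) else 0))
      ≡ (if b then Σ⁺ (W ∩ c) (λ S → Σ⁺ (W ∩ ∁ c) (λ T → g (S ∪ T))) else 0)
    both true  χ≡b = Σ⁺-cong (W ∩ c) λ S S≢∅ S⊆ → Σ⁺-cong (W ∩ ∁ c) λ T T≢∅ T⊆ →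
      cong (if_then g (S ∪ T) else 0) (χ≡b S T S≢∅ S⊆ T≢∅ T⊆)
    both false χ≡b = trans
      (Σ⁺-cong (W ∩ c) λ S S≢∅ S⊆ → trans
        (Σ⁺-cong (W ∩ ∁ c) λ T T≢∅ T⊆ →
          cong (if_then g (S ∪ T) else 0) (χ≡b S T S≢∅ S⊆ T≢∅ T⊆))
        (Σ⁺-zero (W ∩ ∁ c)))
      (Σ⁺-zero (W ∩ c))

  -- c and s leave out the singletons.
  record Bounds (ℓ : Bool) (W : Subset n) : Set where
    field
      c s    : ℕ
      count≡ : count W ≡ c + (if ℓ then ∣ W ∣ else 0)
      size≡  : size W ≡ s + (if ℓ then ∣ W ∣ else 0)
      bound₁ : suc (2 * s) ℕ.≤ suc ∣ W ∣ * c + ∣ W ∣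
      bound₂ : 2 * s ℕ.≤ (2 + ∣ W ∣) * c

-- Keeps the singletons apart when two sides are combined: those of the sides make up those of `W`,
-- and `b` here is the contribution of the sets meeting both sides.
merge-leaves : ∀ {n} ℓ (W c : Subset n) b p q {m} →
  m ≡ p + (if ℓ then ∣ W ∩ c ∣ else 0) + (q + (if ℓ then ∣ W ∩ ∁ c ∣ else 0)) + b →
  m ≡ (p + q + b) + (if ℓ then ∣ W ∣ else 0)
merge-leaves true  W c b p q refl = trans
  (rearrange p q b ∣ W ∩ c ∣ ∣ W ∩ ∁ c ∣) (cong (p + q + b +_) (∣W∩c∣+∣W∩∁c∣≡∣W∣ W c))
  where
  rearrange : ∀ p q b x y → p + x + (q + y) + b ≡ (p + q + b) + (x + y)
  rearrange = solve-∀
merge-leaves false W c b p q refl = rearrange p q b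
  where
  rearrange : ∀ p q b → p + 0 + (q + 0) + b ≡ p + q + b + 0
  rearrange = solve-∀

-- Both bounds at a node come from `bound₂` of its two children, assumed here as `hX` and `hY`.
module ChildBounds (x y cX sX cY sY : ℕ)
  (hX : 2 * sX ℕ.≤ (2 + x) * cX) (hY : 2 * sY ℕ.≤ (2 + y) * cY) where

  -- As `x` and `y` are positive, 2 + x and 2 + y are at most 1 + x + y. The result yields both
  -- bounds at a node with `b` false.
  union-bound : 1 ℕ.≤ x → 1 ℕ.≤ y → 2 * (sX + sY + 0) ℕ.≤ suc (x + y) * (cX + cY + 0)
  union-bound (s≤s {n = x′} _) (s≤s {n = y′} _) = begin
    2 * (sX + sY + 0)              ≡⟨ distrib sX sY ⟩
    2 * sX + 2 * sY                ≤⟨ +-mono-≤ hX hY ⟩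
    (2 + x) * cX + (2 + y) * cY    ≤⟨ m≤m+n _ (y′ * cX + x′ * cY) ⟩
    (2 + x) * cX + (2 + y) * cY + (y′ * cX + x′ * cY) ≡⟨ identity x′ y′ cX cY ⟩
    suc (x + y) * (cX + cY + 0)    ∎
    where
    open ≤-Reasoning
    distrib : ∀ a b → 2 * (a + b + 0) ≡ 2 * a + 2 * b
    distrib = solve-∀
    identity : ∀ x y a b → (3 + x) * a + (3 + y) * b + (y * a + x * b)
                         ≡ suc (suc x + suc y) * (a + b + 0)
    identity = solve-∀

  -- At a join, `u` and `v` are the numbers of nonempty subsets of the two sides, `u * v` is the
  -- number of sets meeting both, and `σ` is their total size.
  module _ (u v σ : ℕ) (2σ≡ : 2 * σ ≡ (x + y) * (u * v) + (x * v + y * u)) where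

    private
      2s≤ : 2 * (sX + sY + σ)
            ℕ.≤ (2 + x) * cX + (2 + y) * cY + ((x + y) * (u * v) + (x * v + y * u))
      2s≤ = begin
        2 * (sX + sY + σ)          ≡⟨ distrib sX sY σ ⟩
        2 * sX + 2 * sY + 2 * σ    ≤⟨ +-mono-≤ (+-mono-≤ hX hY) (≤-reflexive 2σ≡) ⟩
        _                          ∎
        where
        open ≤-Reasoning
        distrib : ∀ a b c → 2 * (a + b + c) ≡ 2 * a + 2 * b + 2 * c
        distrib = solve-∀

    -- What has to be shown for the new sets is x v + y u ≤ 2 u v, and the difference is (u - x) v +
    -- (v - y) u.
    join-bound₂ : x ℕ.≤ u → y ℕ.≤ v → 2 * (sX + sY + σ) ℕ.≤ (2 + (x + y)) * (cX + cY + u * v)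
    join-bound₂ x≤u y≤v with p , refl ← m≤n⇒∃[o]m+o≡n x≤u | q , refl ← m≤n⇒∃[o]m+o≡n y≤v =
      ≤-trans 2s≤ (≤-trans (m≤m+n _ (y * cX + x * cY + (p * v + q * u)))
        (≤-reflexive (identity x y p q cX cY)))
      where
      identity : ∀ x y p q a b →
        (2 + x) * a + (2 + y) * b
          + ((x + y) * ((x + p) * (y + q)) + (x * (y + q) + y * (x + p)))
          + (y * a + x * b + (p * (y + q) + q * (x + p)))
        ≡ (2 + (x + y)) * (a + b + (x + p) * (y + q))
      identity = solve-∀

    -- Uses (u - x)(v - y) ≥ (x - 1)(y - 1).
    join-bound₁ : 1 ℕ.≤ x → 1 ℕ.≤ y → 2 * x ℕ.≤ suc u → 2 * y ℕ.≤ suc v →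
      suc (2 * (sX + sY + σ)) ℕ.≤ suc (x + y) * (cX + cY + u * v) + (x + y)
    join-bound₁ (s≤s {n = x′} _) (s≤s {n = y′} _) 2x≤ 2y≤
      with p , refl ← m≤n⇒∃[o]m+o≡n 2x≤ | q , refl ← m≤n⇒∃[o]m+o≡n 2y≤ =
      ≤-trans (s≤s 2s≤) (≤-trans
        -- Here u - x = x′ + p and v - y = y′ + q, so the last summand is the excess of (u - x)(v -
        -- y) over x′ y′.
        (m≤m+n _ (y′ * cX + x′ * cY + (x′ * q + p * y′ + p * q)))
        (≤-reflexive (identity x′ y′ p q cX cY)))
      where
      identity : ∀ x y p q a b →
        let u = x + suc (x + 0) + p ; v = y + suc (y + 0) + q in
        suc ((3 + x) * a + (3 + y) * b
          + ((suc x + suc y) * (u * v) + (suc x * v + suc y * u)))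
          + (y * a + x * b + (x * q + p * y + p * q))
        ≡ suc (suc x + suc y) * (a + b + u * v) + (suc x + suc y)
      identity = solve-∀

0<∣p∣ : ∀ {n} {p : Subset n} → Nonempty p → 1 ℕ.≤ ∣ p ∣
0<∣p∣ {p = p} (x , x∈p) = subst (ℕ._≤ ∣ p ∣) (∣⁅x⁆∣≡1 x)
  (p⊆q⇒∣p∣≤∣q∣ λ y∈⁅x⁆ → subst (_∈ₛ p) (sym (x∈⁅y⁆⇒x≡y x y∈⁅x⁆)) x∈p)

2*n≤2^n : ∀ n → 2 * n ℕ.≤ 2 ^ n
2*n≤2^n zero          = z≤n
2*n≤2^n (suc zero)    = ≤-refl
2*n≤2^n (suc (suc n)) = begin
  2 * suc (suc n)           ≡⟨ *-suc 2 (suc n) ⟩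
  2 + 2 * suc n             ≤⟨ +-mono-≤ (m≤m*n 2 (2 ^ n) {{m^n≢0 2 n}}) (2*n≤2^n (suc n)) ⟩
  2 * 2 ^ n + 2 * 2 ^ n     ≡⟨ cong (2 * 2 ^ n +_) (sym (+-identityʳ _)) ⟩
  2 ^ suc (suc n)           ∎
  where open ≤-Reasoning

2∣W∣≤suc-Σ⁺-one : ∀ {n} (W : Subset n) → 2 * ∣ W ∣ ℕ.≤ suc (Σ⁺ W (λ _ → 1))
2∣W∣≤suc-Σ⁺-one W = ≤-trans (2*n≤2^n ∣ W ∣) (≤-reflexive (sym (suc-Σ⁺-one W)))

∣W∣≤Σ⁺-one : ∀ {n} (W : Subset n) → 1 ℕ.≤ ∣ W ∣ → ∣ W ∣ ℕ.≤ Σ⁺ W (λ _ → 1)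
∣W∣≤Σ⁺-one W 1≤w = ℕ.s≤s⁻¹ (≤-trans (+-monoʳ-≤ 1 (m≤m+n ∣ W ∣ 0))
  (≤-trans (+-monoˡ-≤ (∣ W ∣ + 0) 1≤w) (2∣W∣≤suc-Σ⁺-one W)))

module _ {n} {χ : Subset n → Bool} {ℓ : Bool} where

  bounds : ∀ {W} → Cotree χ ℓ W → Bounds χ ℓ W
  bounds {W} (leaf ∣W∣≡1 χ≡ℓ) = record
    { c = 0 ; s = 0
    ; count≡ = trans (weight-leaf χ _ χ≡ℓ) (cong (if ℓ then_else 0) Σ⁺-one≡∣W∣)
    ; size≡  = trans (weight-leaf χ _ χ≡ℓ) (cong (if ℓ then_else 0) Σ⁺-∣∣≡∣W∣)
    -- With `c` and `s` zero this reads 1 ≤ `∣ W ∣`.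
    ; bound₁ = ≤-trans (≤-reflexive (sym ∣W∣≡1)) (m≤n+m ∣ W ∣ _)
    ; bound₂ = z≤n
    }
    where
    Σ⁺-one≡∣W∣ : Σ⁺ W (λ _ → 1) ≡ ∣ W ∣
    Σ⁺-one≡∣W∣ = suc-injective
      (trans (suc-Σ⁺-one W) (trans (cong (2 ^_) ∣W∣≡1) (cong suc (sym ∣W∣≡1))))
    Σ⁺-∣∣≡∣W∣ : Σ⁺ W ∣_∣ ≡ ∣ W ∣
    Σ⁺-∣∣≡∣W∣ = *-cancelˡ-≡ _ _ 2 (trans (2*Σ⁺-∣∣ W) (trans
      (cong (λ k → ∣ W ∣ * suc k) (trans Σ⁺-one≡∣W∣ ∣W∣≡1)) (*-comm ∣ W ∣ 2)))
  bounds {W} (node c b X≢∅ Y≢∅ χ≡b tX tY) = combine b χ≡b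
    where
    X = W ∩ c
    Y = W ∩ ∁ c
    module X = Bounds (bounds tX)
    module Y = Bounds (bounds tY)
    1≤x = 0<∣p∣ X≢∅
    1≤y = 0<∣p∣ Y≢∅
    w≡ = ∣W∩c∣+∣W∩∁c∣≡∣W∣ W c

    open ChildBounds ∣ X ∣ ∣ Y ∣ X.c X.s Y.c Y.s X.bound₂ Y.bound₂

    combine : ∀ b →
      (∀ S T → Nonempty S → S ⊆ X → Nonempty T → T ⊆ Y → χ (S ∪ T) ≡ b) → Bounds χ ℓ W
    combine true χ≡b = record
      { c = X.c + Y.c + u * v
      ; s = X.s + Y.s + σ
      ; count≡ = merge-leaves ℓ W c (u * v) X.c Y.c (trans (weight-node χ c true χ≡b _)
          (cong₂ _+_ (cong₂ _+_ X.count≡ Y.count≡) (Σ⁺-both-one W c)))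
      ; size≡  = merge-leaves ℓ W c σ X.s Y.s (trans (weight-node χ c true χ≡b _)
          (cong₂ _+_ (cong₂ _+_ X.size≡ Y.size≡) refl))
      ; bound₁ = subst (λ w → suc (2 * (X.s + Y.s + σ)) ℕ.≤ suc w * (X.c + Y.c + u * v) + w) w≡
          (join-bound₁ u v σ (2*Σ⁺-both-∣∣ W c) 1≤x 1≤y
            (2∣W∣≤suc-Σ⁺-one X) (2∣W∣≤suc-Σ⁺-one Y))
      ; bound₂ = subst (λ w → 2 * (X.s + Y.s + σ) ℕ.≤ (2 + w) * (X.c + Y.c + u * v)) w≡
          (join-bound₂ u v σ (2*Σ⁺-both-∣∣ W c) (∣W∣≤Σ⁺-one X 1≤x) (∣W∣≤Σ⁺-one Y 1≤y))
      }
      where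
      u = Σ⁺ X (λ _ → 1)
      v = Σ⁺ Y (λ _ → 1)
      σ = Σ⁺ X (λ S → Σ⁺ Y (λ T → ∣ S ∪ T ∣))
    combine false χ≡b = record
      { c = c′
      ; s = s
      ; count≡ = merge-leaves ℓ W c 0 X.c Y.c (trans (weight-node χ c false χ≡b _)
          (cong (_+ 0) (cong₂ _+_ X.count≡ Y.count≡)))
      ; size≡  = merge-leaves ℓ W c 0 X.s Y.s (trans (weight-node χ c false χ≡b _)
          (cong (_+ 0) (cong₂ _+_ X.size≡ Y.size≡)))
      ; bound₁ = subst (λ w → suc (2 * s) ℕ.≤ suc w * c′ + w) w≡
          -- The extra 1 on the left is paid for by `∣ X ∣`, which is part of the summand `w` on the
          -- right.
          (≤-trans (+-mono-≤ 1≤x 2s≤) (≤-trans (≤-reflexive (+-comm ∣ X ∣ _))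
            (+-monoʳ-≤ (suc (∣ X ∣ + ∣ Y ∣) * c′) (m≤m+n ∣ X ∣ ∣ Y ∣))))
      ; bound₂ = subst (λ w → 2 * s ℕ.≤ (2 + w) * c′) w≡
          (≤-trans 2s≤ (*-monoˡ-≤ c′ (n≤1+n (suc (∣ X ∣ + ∣ Y ∣)))))
      }
      where
      c′ = X.c + Y.c + 0
      s = X.s + Y.s + 0
      2s≤ : 2 * s ℕ.≤ suc (∣ X ∣ + ∣ Y ∣) * c′
      2s≤ = union-bound 1≤x 1≤y

-- Each child contributes a 1 on the left, so the sum has 2 to spare, which gives strictness. The
-- factors 1 + x and 1 + y are at most x + y.
union-strict-bound : ∀ x y cX sX cY sY →
  suc (2 * sX) ℕ.≤ suc x * cX + x → suc (2 * sY) ℕ.≤ suc y * cY + y → 1 ℕ.≤ x → 1 ℕ.≤ y →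
  2 * (sX + sY + 0) ℕ.< (x + y) * (cX + cY + 0) + (x + y)
union-strict-bound x@(suc x′) y@(suc y′) cX sX cY sY hX hY _ _ = begin-strict
  2 * (sX + sY + 0)                              <⟨ n<1+n _ ⟩
  suc (2 * (sX + sY + 0))                        <⟨ n<1+n _ ⟩
  2 + 2 * (sX + sY + 0)                          ≡⟨ distrib sX sY ⟩
  suc (2 * sX) + suc (2 * sY)                    ≤⟨ +-mono-≤ hX hY ⟩
  suc x * cX + x + (suc y * cY + y)              ≤⟨ m≤m+n _ (y′ * cX + x′ * cY) ⟩
  suc x * cX + x + (suc y * cY + y) + (y′ * cX + x′ * cY) ≡⟨ identity x′ y′ cX cY ⟩
  (x + y) * (cX + cY + 0) + (x + y)              ∎
  where
  open ≤-Reasoning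
  distrib : ∀ a b → 2 + 2 * (a + b + 0) ≡ suc (2 * a) + suc (2 * b)
  distrib = solve-∀
  identity : ∀ x y a b →
    (2 + x) * a + suc x + ((2 + y) * b + suc y) + (y * a + x * b)
    ≡ (suc x + suc y) * (a + b + 0) + (suc x + suc y)
  identity = solve-∀

W∩c∪W∩∁c≡W : ∀ {n} (W c : Subset n) → (W ∩ c) ∪ (W ∩ ∁ c) ≡ W
W∩c∪W∩∁c≡W W c = trans (sym (∩-distribˡ-∪ W c (∁ c)))
  (trans (cong (W ∩_) (p∪∁p≡⊤ c)) (∩-identityʳ W))

-- Here the root is a leaf or a node with b = false, and the bound comes from
-- bound₁ of its two children.
strict-bound : ∀ {n} {χ : Subset n → Bool} {W} → χ W ≡ false → Cotree χ false W →
               2 * size χ W ℕ.< ∣ W ∣ * count χ W + ∣ W ∣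
strict-bound {χ = χ} {W} χW (leaf ∣W∣≡1 χ≡ℓ)
  rewrite weight-leaf χ ∣_∣ χ≡ℓ | ∣W∣≡1 = m≤n+m 1 _
-- The two full sides have union `W`, so a join at the root would make `χ W` true.
strict-bound {χ = χ} {W} χW (node c true X≢∅ Y≢∅ χ≡b tX tY)
  with () ← trans (sym (χ≡b _ _ X≢∅ id Y≢∅ id)) (trans (cong χ (W∩c∪W∩∁c≡W W c)) χW)
strict-bound {χ = χ} {W} χW (node c false X≢∅ Y≢∅ χ≡b tX tY) = begin-strict
  2 * size χ W                       ≡⟨ cong (2 *_) size≡ ⟩
  2 * (X.s + Y.s + 0)
    <⟨ union-strict-bound x y X.c X.s Y.c Y.s X.bound₁ Y.bound₁ (0<∣p∣ X≢∅) (0<∣p∣ Y≢∅) ⟩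
  (x + y) * (X.c + Y.c + 0) + (x + y)
    ≡⟨ cong₂ (λ k l → k * l + k) (∣W∩c∣+∣W∩∁c∣≡∣W∣ W c) (sym count≡) ⟩
  ∣ W ∣ * count χ W + ∣ W ∣          ∎
  where
  open ≤-Reasoning
  module X = Bounds (bounds tX)
  module Y = Bounds (bounds tY)
  x = ∣ W ∩ c ∣
  y = ∣ W ∩ ∁ c ∣
  size≡ : size χ W ≡ X.s + Y.s + 0
  size≡ = trans (weight-node χ c false χ≡b _) (cong (_+ 0)
    (cong₂ _+_ (trans X.size≡ (+-identityʳ _)) (trans Y.size≡ (+-identityʳ _))))
  count≡ : count χ W ≡ X.c + Y.c + 0
  count≡ = trans (weight-node χ c false χ≡b _) (cong (_+ 0)
    (cong₂ _+_ (trans X.count≡ (+-identityʳ _)) (trans Y.count≡ (+-identityʳ _))))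

-- Cotrees of P₄-free graphs

module _ {n} (e : Fin n → Fin n → Bool) where

  -- For symmetric and loopless `e` the six conditions already force the four vertices to be
  -- distinct.
  P₄-Free : Set
  P₄-Free = ∀ a b c d → e a b ≡ true → e b c ≡ true → e c d ≡ true →
            e a c ≡ false → e a d ≡ false → e b d ≡ false → ⊥

  Monochromatic : (Fin n → Bool) → Bool → List (Fin n) → Set
  Monochromatic c b L =
    ∀ {x y} → x ∈ L → y ∈ L → c x ≡ true → c y ≡ false → e x y ≡ b

  -- With `b` false the graph on `L` is disconnected; with `b` true its complement is.
  record Split (L : List (Fin n)) : Set where
    constructor split
    field
      c    : Fin n → Bool
      b    : Bool
      left : ∃[ x ] x ∈ L × c x ≡ true
      rght : ∃[ y ] y ∈ L × c y ≡ false
      mono : Monochromatic c b L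

  module _ (e-sym : ∀ u v → e u v ≡ e v u) (p₄-free : P₄-Free) where

    -- P₄ is self-complementary.
    no-P₄ : ∀ t a b c d → e a b ≡ t → e b c ≡ t → e c d ≡ t →
            e a c ≡ not t → e a d ≡ not t → e b d ≡ not t → ⊥
    no-P₄ true  a b c d ab bc cd ac ad bd = p₄-free a b c d ab bc cd ac ad bd
    -- The complement of the path a, b, c, d is the path b, d, a, c.
    no-P₄ false a b c d ab bc cd ac ad bd =
      p₄-free b d a c bd (trans (e-sym d a) ad) ac (trans (e-sym b a) ab) bc (trans (e-sym d c) cd)

    flip-mono : ∀ {c b L} → Monochromatic c b L → Monochromatic (not ∘ c) b L
    flip-mono mono {x} {y} x∈ y∈ cx cy =
      trans (e-sym x y) (mono y∈ x∈ (not-flip cy) (not-flip cx))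
      where
      not-flip : ∀ {p q} → not p ≡ q → p ≡ not q
      not-flip {p} refl = sym (not-involutive p)

    -- The vertex `v` joins the class of colour false. As `v` is not in `L`, recolouring it leaves
    -- the old vertices as they were.
    extend : ∀ {v L} → ¬ (v ∈ L) → ∀ c b → ∃[ x ] (x ∈ L × c x ≡ true) → Monochromatic c b L →
             (∀ {x} → x ∈ L → c x ≡ true → e v x ≡ b) → Split (v ∷ L)
    extend {v} {L} v∉L c b (x , x∈L , cx) mono v-mono =
      split c′ b (x , there x∈L , trans (c′≡c x∈L) cx) (v , here refl , c′v) mono′
      where
      c′ : Fin n → Bool
      c′ w = if does (w ≟ v) then false else c w
      c′v : c′ v ≡ false
      c′v = cong (if_then false else c v) (dec-true (v ≟ v) refl)
      c′≡c : ∀ {w} → w ∈ L → c′ w ≡ c w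
      c′≡c {w} w∈L = cong (if_then false else c w) (dec-false (w ≟ v) λ { refl → v∉L w∈L })
      mono′ : Monochromatic c′ b (v ∷ L)
      mono′ (here refl) _ c′v≡true _ with () ← trans (sym c′v) c′v≡true
      mono′ (there x∈L) (here refl) cx _  =
        trans (e-sym _ v) (v-mono x∈L (trans (sym (c′≡c x∈L)) cx))
      mono′ (there x∈L) (there y∈L) cx cy =
        mono x∈L y∈L (trans (sym (c′≡c x∈L)) cx) (trans (sym (c′≡c y∈L)) cy)

    -- The vertices x of colour true with e v x ≡ b split off: if y also has
    -- colour true but e v y ≡ not b, then e x y ≡ b, or else x, y, v, r is a P₄.
    extend-mixed : ∀ {v L} → ¬ (v ∈ L) → ∀ c b → Monochromatic c b L →
                   ∃[ q ] (q ∈ L × c q ≡ true × e v q ≡ b) →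
                   ∃[ r ] (r ∈ L × c r ≡ false × e v r ≡ not b) → Split (v ∷ L)
    extend-mixed {v} {L} v∉L c b mono (q , q∈L , cq , vq) (r , r∈L , cr , vr) =
      extend v∉L c′ b (q , q∈L , c′q) mono′ (λ _ → proj₂ ∘ c′⁻)
      where
      c′ : Fin n → Bool
      c′ w = c w ∧ does (e v w ≟ᵇ b)
      c′q : c′ q ≡ true
      c′q = cong₂ _∧_ cq (dec-true (e v q ≟ᵇ b) vq)
      c′⁻ : ∀ {w} → c′ w ≡ true → c w ≡ true × e v w ≡ b
      c′⁻ {w} c′w with c w | e v w ≟ᵇ b
      ... | true | yes vw = refl , vw
      mono′ : Monochromatic c′ b L
      mono′ {x} {y} x∈L y∈L c′x c′y with cx , vx ← c′⁻ c′x | c y in cy | e v y ≟ᵇ b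
      ... | false | _      = mono x∈L y∈L cx cy
      ... | true  | no vy with e x y ≟ᵇ b
      ...   | yes xy = xy
      ...   | no  xy = ⊥-elim (no-P₄ (not b) x y v r (¬-not xy)
                (trans (e-sym y v) (¬-not vy)) vr
                (not² (trans (e-sym x v) vx)) (not² (mono x∈L r∈L cx cr))
                (not² (mono y∈L r∈L cy cr)))
        where
        not² : ∀ {a} → a ≡ b → a ≡ not (not b)
        not² refl = sym (not-involutive b)

    search : ∀ v L (c : Fin n → Bool) k b → (∀ {w} → w ∈ L → c w ≡ k → e v w ≡ b)
                                            ⊎ ∃[ w ] (w ∈ L × c w ≡ k × e v w ≡ not b)
    search v L c k b with All.decide decide L
      where
      decide : ∀ w → (c w ≡ k → e v w ≡ b) ⊎ (c w ≡ k × e v w ≡ not b)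
      decide w with c w ≟ᵇ k | e v w ≟ᵇ b
      ... | _      | yes vw = inj₁ λ _ → vw
      ... | yes cw | no vw  = inj₂ (cw , ¬-not vw)
      ... | no cw  | no _   = inj₁ (⊥-elim ∘ cw)
    ... | inj₁ ∀w = inj₁ (All.lookup ∀w)
    ... | inj₂ ∃w = inj₂ (find ∃w)

    -- If `v` relates by `b` to a whole class, it joins the other class. If it relates by `not b` to
    -- every vertex, it splits off alone. Otherwise some `q` relates to `v` by `b`, and the class
    -- opposite to that of `q` has a vertex related to `v` by `not b`, as `extend-mixed` requires.
    insert : ∀ {v L} → ¬ (v ∈ L) → Split L → Split (v ∷ L)
    insert {v} {L} v∉L (split c b (x , x∈L , cx) (y , y∈L , cy) mono)
      with search v L c true b | search v L c false b | search v L (λ _ → true) true (not b)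
    ... | inj₁ ∀x | _ | _ = extend v∉L c b (x , x∈L , cx) mono ∀x
    ... | inj₂ _ | inj₁ ∀y | _ = extend v∉L (not ∘ c) b (y , y∈L , cong not cy) (flip-mono mono)
                                   λ w∈L cw → ∀y w∈L (not-injective cw)
    ... | inj₂ _ | inj₂ _ | inj₁ ∀w =
      extend v∉L (λ _ → true) (not b) (x , x∈L , refl) (λ _ _ _ ()) ∀w
    ... | inj₂ (p , p∈L , cp , vp) | inj₂ (r , r∈L , cr , vr) | inj₂ (q , q∈L , _ , vq)
      with c q in cq
    ...   | true  = extend-mixed v∉L c b mono
                      (q , q∈L , cq , trans vq (not-involutive b)) (r , r∈L , cr , vr)
    ...   | false = extend-mixed v∉L (not ∘ c) b (flip-mono mono)
                      (q , q∈L , cong not cq , trans vq (not-involutive b))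
                      (p , p∈L , cong not cp , vp)

    -- Seinsche's theorem: a P₄-free graph with at least two vertices is disconnected or has a
    -- disconnected complement. Vertices are inserted one at a time; a repeated entry of the list
    -- changes nothing.
    singleton-or-split : ∀ v L → (∀ {w} → w ∈ v ∷ L → w ≡ v) ⊎ Split (v ∷ L)
    singleton-or-split v []      = inj₁ λ { (here w≡v) → w≡v }
    singleton-or-split v (u ∷ L) with DecMembership._∈?_ _≟_ v (u ∷ L) | singleton-or-split u L
    ... | yes v∈ | inj₁ ∀≡u =
      inj₁ λ { (here w≡v) → w≡v ; (there w∈) → trans (∀≡u w∈) (sym (∀≡u v∈)) }
    ... | yes v∈ | inj₂ (split c b (x , x∈ , cx) (y , y∈ , cy) mono) =
      inj₂ (split c b (x , there x∈ , cx) (y , there y∈ , cy)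
        λ x∈ y∈ → mono (absorb x∈) (absorb y∈))
      where
      absorb : ∀ {w} → w ∈ v ∷ u ∷ L → w ∈ u ∷ L
      absorb (here refl) = v∈
      absorb (there w∈)  = w∈
    ... | no v∉ | inj₁ ∀≡u = inj₂ (extend v∉ (λ _ → true) (e v u) (u , here refl , refl)
                                     (λ _ _ _ ()) λ w∈ _ → cong (e v) (∀≡u w∈))
    ... | no v∉ | inj₂ s   = inj₂ (insert v∉ s)

    module _ {χ : Subset n → Bool}
      (χ-singleton : ∀ v S → Nonempty S → (∀ {w} → w ∈ₛ S → w ≡ v) → χ S ≡ true)
      (χ-join : ∀ b S T → Nonempty S → Nonempty T → (∀ {w} → w ∈ₛ S → ¬ w ∈ₛ T) →
                (∀ {s t} → s ∈ₛ S → t ∈ₛ T → e s t ≡ b) → χ (S ∪ T) ≡ b)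
      where

      -- Splitting is repeated on both classes. Each is nonempty, so the other is smaller than `W`
      -- and the recursion on the size ends.
      cotree : ∀ W → Nonempty W → Cotree χ true W
      cotree W W≢∅ = build W W≢∅ (<-wellFounded ∣ W ∣)
        where
        build : ∀ W → Nonempty W → Acc ℕ._<_ ∣ W ∣ → Cotree χ true W
        build W (v₀ , v₀∈W) (acc smaller) = from-elements elements ∈⇒∈ₛ ∈ₛ⇒∈
          where
          elements = filter (_∈? W) (allFin n)
          ∈ₛ⇒∈ : ∀ {w} → w ∈ₛ W → w ∈ elements
          ∈ₛ⇒∈ w∈W = ∈-filter⁺ (_∈? W) (∈-allFin _) w∈W
          ∈⇒∈ₛ : ∀ {w} → w ∈ elements → w ∈ₛ W
          ∈⇒∈ₛ w∈ = proj₂ (∈-filter⁻ (_∈? W) {xs = allFin n} w∈)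

          from-elements : ∀ L → (∀ {w} → w ∈ L → w ∈ₛ W) → (∀ {w} → w ∈ₛ W → w ∈ L) →
                          Cotree χ true W
          from-elements []      L⊆W W⊆L with () ← W⊆L v₀∈W
          from-elements (v ∷ L) L⊆W W⊆L with singleton-or-split v L
          ... | inj₁ ∀≡v = leaf (trans (cong ∣_∣ W≡⁅v⁆) (∣⁅x⁆∣≡1 v))
                  λ S S≢∅ S⊆W → χ-singleton v S S≢∅ λ w∈S → ∀≡v (W⊆L (S⊆W w∈S))
            where
            W≡⁅v⁆ : W ≡ ⁅ v ⁆
            W≡⁅v⁆ = ⊆-antisym
              (λ w∈W → subst (_∈ₛ ⁅ v ⁆) (sym (∀≡v (W⊆L w∈W))) (x∈⁅x⁆ v))
              (λ w∈⁅v⁆ → subst (_∈ₛ W) (sym (x∈⁅y⁆⇒x≡y v w∈⁅v⁆)) (L⊆W (here refl)))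
          ... | inj₂ (split c b (x , x∈L , cx) (y , y∈L , cy) mono) =
            node C b X≢∅ Y≢∅ χ≡b (build _ X≢∅ (smaller ∣X∣<∣W∣)) (build _ Y≢∅ (smaller ∣Y∣<∣W∣))
            where
            C = tabulate c
            ∈C : ∀ {w} → c w ≡ true → w ∈ₛ C
            ∈C {w} cw = lookup⇒[]= w C (trans (lookup∘tabulate c w) cw)
            ∈C⁻ : ∀ {w} → w ∈ₛ C → c w ≡ true
            ∈C⁻ {w} w∈C = trans (sym (lookup∘tabulate c w)) ([]=⇒lookup w∈C)
            ∉C : ∀ {w} → c w ≡ false → w ∈ₛ ∁ C
            ∉C cw = x∉p⇒x∈∁p λ w∈C → case (trans (sym cw) (∈C⁻ w∈C)) of λ ()
            ∉C⁻ : ∀ {w} → w ∈ₛ ∁ C → c w ≡ false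
            ∉C⁻ w∈∁C = ¬-not λ cw → x∈∁p⇒x∉p w∈∁C (∈C cw)
            X≢∅ : Nonempty (W ∩ C)
            X≢∅ = x , x∈p∩q⁺ (L⊆W x∈L , ∈C cx)
            Y≢∅ : Nonempty (W ∩ ∁ C)
            Y≢∅ = y , x∈p∩q⁺ (L⊆W y∈L , ∉C cy)
            ∣X∣<∣W∣ : ∣ W ∩ C ∣ ℕ.< ∣ W ∣
            ∣X∣<∣W∣ = ≤-trans (≤-reflexive (+-comm 1 _)) (≤-trans
              (+-monoʳ-≤ ∣ W ∩ C ∣ (0<∣p∣ Y≢∅)) (≤-reflexive (∣W∩c∣+∣W∩∁c∣≡∣W∣ W C)))
            ∣Y∣<∣W∣ : ∣ W ∩ ∁ C ∣ ℕ.< ∣ W ∣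
            ∣Y∣<∣W∣ = ≤-trans (+-monoˡ-≤ ∣ W ∩ ∁ C ∣ (0<∣p∣ X≢∅))
              (≤-reflexive (∣W∩c∣+∣W∩∁c∣≡∣W∣ W C))
            χ≡b : ∀ S T → Nonempty S → S ⊆ W ∩ C → Nonempty T → T ⊆ W ∩ ∁ C → χ (S ∪ T) ≡ b
            χ≡b S T S≢∅ S⊆X T≢∅ T⊆Y = χ-join b S T S≢∅ T≢∅
              (λ w∈S w∈T → x∈∁p⇒x∉p (p∩q⊆q W (∁ C) (T⊆Y w∈T)) (p∩q⊆q W C (S⊆X w∈S)))
              λ s∈S t∈T → mono (W⊆L (p∩q⊆p W C (S⊆X s∈S))) (W⊆L (p∩q⊆p W (∁ C) (T⊆Y t∈T)))
                               (∈C⁻ (p∩q⊆q W C (S⊆X s∈S))) (∉C⁻ (p∩q⊆q W (∁ C) (T⊆Y t∈T)))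

-- Makes the bounds available for the disconnected sets, where singletons carry the value false.
Cotree-not : ∀ {n} {χ : Subset n → Bool} {ℓ W} → Cotree χ ℓ W → Cotree (not ∘ χ) (not ℓ) W
Cotree-not (leaf ∣W∣≡1 χ≡ℓ) = leaf ∣W∣≡1 λ S S≢∅ S⊆W → cong not (χ≡ℓ S S≢∅ S⊆W)
Cotree-not (node c b X≢∅ Y≢∅ χ≡b tX tY) =
  node c (not b) X≢∅ Y≢∅ (λ S T S≢∅ S⊆ T≢∅ T⊆ → cong not (χ≡b S T S≢∅ S⊆ T≢∅ T⊆))
       (Cotree-not tX) (Cotree-not tY)

-- Adjacency and connected sets in a cograph

module _ (G : Graph) where
  open Graph G using (Vertex; order; _~_; _~?_; symm; irrefl)

  adjacent : Vertex → Vertex → Bool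
  adjacent u v = does (u ~? v)

  adjacent-true : ∀ {u v} → adjacent u v ≡ true → u ~ v
  adjacent-true {u} {v} eq with u ~? v
  ... | yes u~v = u~v

  adjacent-false : ∀ {u v} → adjacent u v ≡ false → ¬ u ~ v
  adjacent-false {u} {v} eq with u ~? v
  ... | no u≁v = u≁v

  adjacent-sym : ∀ u v → adjacent u v ≡ adjacent v u
  adjacent-sym u v with v ~? u
  ... | yes v~u = dec-true (u ~? v) (symm v~u)
  ... | no  v≁u = dec-false (u ~? v) (v≁u ∘ symm)

  private module P = Graph (path 4)

  cograph⇒P₄-free : Cograph G → P₄-Free adjacent
  cograph⇒P₄-free cograph a b c d ab bc cd ac ad bd = cograph (f , f-inj , f-hom)
    where
    f : Fin 4 → Vertex
    f zero                   = a
    f (suc zero)             = b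
    f (suc (suc zero))       = c
    f (suc (suc (suc zero))) = d
    loop : ∀ v → adjacent v v ≡ false
    loop v = dec-false (v ~? v) (irrefl refl)
    flip : ∀ {u v b} → adjacent u v ≡ b → adjacent v u ≡ b
    flip = trans (adjacent-sym _ _)
    table : ∀ i j → adjacent (f i) (f j) ≡ does (i P.~? j)
    table zero                   zero                   = loop a
    table zero                   (suc zero)             = ab
    table zero                   (suc (suc zero))       = ac
    table zero                   (suc (suc (suc zero))) = ad
    table (suc zero)             zero                   = flip ab
    table (suc zero)             (suc zero)             = loop b
    table (suc zero)             (suc (suc zero))       = bc
    table (suc zero)             (suc (suc (suc zero))) = bd
    table (suc (suc zero))       zero                   = flip ac
    table (suc (suc zero))       (suc zero)             = flip bc
    table (suc (suc zero))       (suc (suc zero))       = loop c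
    table (suc (suc zero))       (suc (suc (suc zero))) = cd
    table (suc (suc (suc zero))) zero                   = flip ad
    table (suc (suc (suc zero))) (suc zero)             = flip bd
    table (suc (suc (suc zero))) (suc (suc zero))       = flip cd
    table (suc (suc (suc zero))) (suc (suc (suc zero))) = loop d
    f-hom : ∀ i j → (i P.~ j) ⇔ (f i ~ f j)
    f-hom i j = mk⇔
      (λ i~j → adjacent-true (trans (table i j) (dec-true (i P.~? j) i~j)))
      (λ fi~fj → does-true (i P.~? j) (trans (sym (table i j)) (dec-true (f i ~? f j) fi~fj)))
      where
      does-true : ∀ {A : Set} (a? : Dec A) → does a? ≡ true → A
      does-true (yes a) _ = a
    -- Distinct vertices of the path on four vertices have distinct neighbourhoods. As `f` preserves
    -- and reflects adjacency, it is therefore injective.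
    twin-free : ∀ i j → (∀ k → does (i P.~? k) ≡ does (j P.~? k)) → i ≡ j
    twin-free = toWitness {a? = all? λ i → all? λ j →
      all? (λ k → does (i P.~? k) ≟ᵇ does (j P.~? k)) →-dec (i ≟ j)} _
    f-inj : ∀ {i j} → f i ≡ f j → i ≡ j
    f-inj {i} {j} fi≡fj = twin-free i j λ k →
      trans (sym (table i k)) (trans (cong (λ v → adjacent v (f k)) fi≡fj) (table j k))

  connected : Subset order → Bool
  connected S = does (inducesConnected? G S)

  connected-singleton : ∀ v S → Nonempty S → (∀ {w} → w ∈ₛ S → w ≡ v) → connected S ≡ true
  connected-singleton v S _ ∀≡v = dec-true (inducesConnected? G S)
    λ u w u∈S w∈S → subst (Star _ u) (trans (∀≡v u∈S) (sym (∀≡v w∈S))) Star.ε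

  -- With all edges across, two vertices on one side are joined through any vertex of the other.
  -- With none, a walk that starts in `S` stays in `S`.
  connected-∪ : ∀ b S T → Nonempty S → Nonempty T → (∀ {w} → w ∈ₛ S → ¬ w ∈ₛ T) →
                (∀ {s t} → s ∈ₛ S → t ∈ₛ T → adjacent s t ≡ b) → connected (S ∪ T) ≡ b
  connected-∪ true S T (s , s∈S) (t , t∈T) _ S~T = dec-true (inducesConnected? G (S ∪ T)) walk
    where
    S⇒T : ∀ {u v} → u ∈ₛ S → v ∈ₛ T → InducedAdj G (S ∪ T) u v
    S⇒T u∈S v∈T = x∈p∪q⁺ (inj₁ u∈S) , x∈p∪q⁺ (inj₂ v∈T) , adjacent-true (S~T u∈S v∈T)
    T⇒S : ∀ {u v} → u ∈ₛ T → v ∈ₛ S → InducedAdj G (S ∪ T) u v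
    T⇒S u∈T v∈S = x∈p∪q⁺ (inj₂ u∈T) , x∈p∪q⁺ (inj₁ v∈S) , symm (adjacent-true (S~T v∈S u∈T))
    walk : InducesConnected G (S ∪ T)
    walk u v u∈ v∈ with x∈p∪q⁻ S T u∈ | x∈p∪q⁻ S T v∈
    ... | inj₁ u∈S | inj₁ v∈S = S⇒T u∈S t∈T ◅ T⇒S t∈T v∈S ◅ Star.ε
    ... | inj₁ u∈S | inj₂ v∈T = S⇒T u∈S v∈T ◅ Star.ε
    ... | inj₂ u∈T | inj₁ v∈S = T⇒S u∈T v∈S ◅ Star.ε
    ... | inj₂ u∈T | inj₂ v∈T = T⇒S u∈T s∈S ◅ S⇒T s∈S v∈T ◅ Star.ε
  connected-∪ false S T (s , s∈S) (t , t∈T) disjoint S≁T =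
    dec-false (inducesConnected? G (S ∪ T)) λ conn →
      disjoint (stays s∈S (conn s t (x∈p∪q⁺ (inj₁ s∈S)) (x∈p∪q⁺ (inj₂ t∈T)))) t∈T
    where
    stays : ∀ {u v} → u ∈ₛ S → Star (InducedAdj G (S ∪ T)) u v → v ∈ₛ S
    stays u∈S Star.ε = u∈S
    stays u∈S ((_ , w∈ , u~w) ◅ walk) with x∈p∪q⁻ S T w∈
    ... | inj₁ w∈S = stays w∈S walk
    ... | inj₂ w∈T = ⊥-elim (adjacent-false (S≁T u∈S w∈T) u~w)

  connected-cotree : Cograph G → ∀ W → Nonempty W → Cotree connected true W
  connected-cotree cograph = cotree adjacent adjacent-sym (cograph⇒P₄-free cograph)
    connected-singleton connected-∪

-- The values of Φ and its derivative at 1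

∑ : ℕ → (ℕ → ℕ) → ℕ
∑ m f = sum (applyUpTo f m)

∑-cong : ∀ m {f g} → (∀ i → f i ≡ g i) → ∑ m f ≡ ∑ m g
∑-cong zero    f≗g = refl
∑-cong (suc m) f≗g = cong₂ _+_ (f≗g 0) (∑-cong m (f≗g ∘ suc))

∑-+ : ∀ m f g → ∑ m (λ i → f i + g i) ≡ ∑ m f + ∑ m g
∑-+ zero    f g = refl
∑-+ (suc m) f g = trans (cong (f 0 + g 0 +_) (∑-+ m (f ∘ suc) (g ∘ suc)))
                        (interchange (f 0) (g 0) _ _)

∑-zero : ∀ m → ∑ m (λ _ → 0) ≡ 0
∑-zero zero    = refl
∑-zero (suc m) = ∑-zero m

∑-indicator : ∀ {m k} (f : ℕ → ℕ) → k ℕ.< m → ∑ m (λ i → if does (k ℕ.≟ i) then f i else 0) ≡ f k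
∑-indicator {suc m} {zero}  f _         = trans (cong (f 0 +_) (∑-zero m)) (+-identityʳ (f 0))
∑-indicator {suc m} {suc k} f (s≤s k<m) = ∑-indicator (f ∘ suc) k<m

eval-1 : ∀ p → eval p 1 ≡ sum p
eval-1 []      = refl
eval-1 (c ∷ p) = cong (c +_) (trans (+-identityʳ _) (eval-1 p))

zipWith-applyUpTo : ∀ (f g : ℕ → ℕ) m →
  zipWith _*_ (applyUpTo f m) (applyUpTo g m) ≡ applyUpTo (λ i → f i * g i) m
zipWith-applyUpTo f g zero    = refl
zipWith-applyUpTo f g (suc m) = cong (f 0 * g 0 ∷_) (zipWith-applyUpTo (f ∘ suc) (g ∘ suc) m)

length-filter-∷ : ∀ {A : Set} {P : Pred A 0ℓ} (P? : Decidable P) x xs →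
  length (filter P? (x ∷ xs)) ≡ (if does (P? x) then 1 else 0) + length (filter P? xs)
length-filter-∷ P? x xs with does (P? x)
... | true  = refl
... | false = refl

sum-subsets : ∀ n (h : Subset n → ℕ) → sum (map h (subsets n)) ≡ Σ⊆ full h
sum-subsets zero    h = +-identityʳ _
sum-subsets (suc n) h = begin
  sum (map h (map (outside ∷_) (subsets n) ++ map (inside ∷_) (subsets n)))
    ≡⟨ cong sum (map-++ h (map (outside ∷_) (subsets n)) _) ⟩
  sum (map h (map (outside ∷_) (subsets n)) ++ map h (map (inside ∷_) (subsets n)))
    ≡⟨ sum-++ (map h (map (outside ∷_) (subsets n))) _ ⟩
  sum (map h (map (outside ∷_) (subsets n))) + sum (map h (map (inside ∷_) (subsets n)))
    ≡⟨ cong₂ (λ k l → sum k + sum l) (map-∘ (subsets n)) (map-∘ (subsets n)) ⟨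
  sum (map (h ∘ (outside ∷_)) (subsets n)) + sum (map (h ∘ (inside ∷_)) (subsets n))
    ≡⟨ cong₂ _+_ (sum-subsets n _) (sum-subsets n _) ⟩
  Σ⊆ full h ∎
  where
  open ≡-Reasoning

module _ (G : Graph) where
  open Graph G using (order)

  private
    hasSize? : ∀ k (S : Subset order) → Dec (∣ S ∣ ≡ k × InducesConnected G S)
    hasSize? k S = (∣ S ∣ ℕ.≟ k) ×-dec inducesConnected? G S

  -- g on positive sizes; the empty set, connected by convention, is not counted by Φ.
  positive : (ℕ → ℕ) → ℕ → ℕ
  positive g zero    = 0
  positive g (suc k) = g (suc k)

  contribution : (ℕ → ℕ) → Subset order → ℕ
  contribution g S = if connected G S then positive g ∣ S ∣ else 0

  -- Only the index `i` with `suc i` equal to `∣ S ∣` contributes; for the empty set there is no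
  -- such index.
  ∑-contribution : ∀ g S →
    ∑ order (λ i → g (suc i) * (if does (hasSize? (suc i) S) then 1 else 0)) ≡ contribution g S
  ∑-contribution g S = by-size ∣ S ∣ (connected G S) (∣p∣≤n S)
    where
    pointwise : ∀ (p q : Bool) k → k * (if p ∧ q then 1 else 0)
                                 ≡ (if p then (if q then k else 0) else 0)
    pointwise true  true  k = *-identityʳ k
    pointwise true  false k = *-zeroʳ k
    pointwise false q     k = *-zeroʳ k
    by-size : ∀ s q → s ℕ.≤ order →
      ∑ order (λ i → g (suc i) * (if does (s ℕ.≟ suc i) ∧ q then 1 else 0))
        ≡ (if q then positive g s else 0)
    by-size zero    q     _     = trans (∑-cong order (λ i → *-zeroʳ (g (suc i))))
      (trans (∑-zero order) (sym (if-const q)))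
      where
      if-const : ∀ q → (if q then 0 else 0) ≡ 0
      if-const true  = refl
      if-const false = refl
    by-size (suc s) q     s<n   = trans
      (∑-cong order (λ i → pointwise (does (s ℕ.≟ i)) q (g (suc i))))
      (∑-indicator (λ i → if q then g (suc i) else 0) s<n)

  ∑-filter : ∀ g xs →
    ∑ order (λ i → g (suc i) * length (filter (hasSize? (suc i)) xs))
      ≡ sum (map (contribution g) xs)
  ∑-filter g []       = trans (∑-cong order (λ i → *-zeroʳ (g (suc i)))) (∑-zero order)
  ∑-filter g (S ∷ xs) = begin
    ∑ order (λ i → g (suc i) * length (filter (hasSize? (suc i)) (S ∷ xs)))
      ≡⟨ ∑-cong order (λ i → trans (cong (g (suc i) *_) (length-filter-∷ (hasSize? (suc i)) S xs))
                                   (*-distribˡ-+ (g (suc i)) _ _)) ⟩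
    ∑ order (λ i → g (suc i) * (if does (hasSize? (suc i) S) then 1 else 0)
                     + g (suc i) * length (filter (hasSize? (suc i)) xs))
      ≡⟨ ∑-+ order _ _ ⟩
    _ ≡⟨ cong₂ _+_ (∑-contribution g S) (∑-filter g xs) ⟩
    sum (map (contribution g) (S ∷ xs)) ∎
    where open ≡-Reasoning

  -- Double counting of the connected sets by size. A constant `g` of 1 gives the value of `Φ` at 1,
  -- and the identity gives that of its derivative.
  ∑-a≡weight : ∀ g → ∑ order (λ i → g (suc i) * a G (suc i)) ≡ weight (connected G) (g ∘ ∣_∣) full
  ∑-a≡weight g = begin
    ∑ order (λ i → g (suc i) * a G (suc i))      ≡⟨ ∑-filter g (subsets order) ⟩
    sum (map (contribution g) (subsets order))   ≡⟨ sum-subsets order _ ⟩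
    Σ⊆ full (contribution g)                     ≡⟨ Σ⊆-∅+Σ⁺ full (contribution g) ⟩
    contribution g ∅ + Σ⁺ full (contribution g)  ≡⟨ cong₂ _+_ ∅-contributes-0
      (Σ⁺-cong full λ S S≢∅ _ → cong (if connected G S then_else 0) (positive≡ (0<∣p∣ S≢∅))) ⟩
    weight (connected G) (g ∘ ∣_∣) full          ∎
    where
    open ≡-Reasoning
    positive≡ : ∀ {k} → 1 ℕ.≤ k → positive g k ≡ g k
    positive≡ (s≤s _) = refl
    ∅-contributes-0 : contribution g ∅ ≡ 0
    ∅-contributes-0 with connected G ∅
    ... | true  = cong (positive g) (∣⊥∣≡0 order)
    ... | false = refl

  Φ[1]≡count : eval (Φ G) 1 ≡ count (connected G) full
  Φ[1]≡count = trans (eval-1 (Φ G))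
    (trans (∑-cong order (λ i → sym (*-identityˡ _))) (∑-a≡weight (λ _ → 1)))

  Φ′[1]≡size : eval (deriv (Φ G)) 1 ≡ size (connected G) full
  Φ′[1]≡size = begin
    eval (deriv (Φ G)) 1
      ≡⟨ eval-1 (deriv (Φ G)) ⟩
    sum (zipWith _*_ (applyUpTo suc (length coeffs)) coeffs)
      ≡⟨ cong (λ m → sum (zipWith _*_ (applyUpTo suc m) coeffs)) (length-applyUpTo _ order) ⟩
    sum (zipWith _*_ (applyUpTo suc order) coeffs)
      ≡⟨ cong sum (zipWith-applyUpTo suc _ order) ⟩
    ∑ order (λ i → suc i * a G (suc i))
      ≡⟨ ∑-a≡weight id ⟩
    size (connected G) full ∎
    where
    open ≡-Reasoning
    coeffs = applyUpTo (λ i → a G (suc i)) order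

-- Bounds on the mean in cross-multiplied form

weight-not : ∀ {n} (χ : Subset n → Bool) g W → weight χ g W + weight (not ∘ χ) g W ≡ Σ⁺ W g
weight-not χ g W = trans (sym (Σ⁺-+ W _ _)) (Σ⁺-cong W λ S _ _ → either (χ S) (g S))
  where
  either : ∀ b k → (if b then k else 0) + (if not b then k else 0) ≡ k
  either true  k = +-identityʳ k
  either false k = refl

module MeanBounds (G : Graph) (G-connected : Connected G) (G-cograph : Cograph G) where
  open Graph G using (order; order-nonZero)

  private
    -- `M G` is the quotient of `T` by `N`; `N̅` and `T̅` are the number and the total size of the
    -- disconnected sets.
    N = eval (Φ G) 1
    T = eval (deriv (Φ G)) 1
    N̅ = count (not ∘ connected G) (full {order})
    T̅ = size (not ∘ connected G) (full {order})
    ∣full∣≡order = ∣⊤∣≡n order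

    full-nonempty : Nonempty (full {order})
    full-nonempty = fromℕ< (ℕ.>-nonZero⁻¹ order) , ∈⊤

    cotree-full : Cotree (connected G) true full
    cotree-full = connected-cotree G G-cograph full full-nonempty

    full-connected : connected G full ≡ true
    full-connected = dec-true (inducesConnected? G full)
      λ u v _ _ → Star.map (λ u~v → ∈⊤ , ∈⊤ , u~v) (G-connected u v)

    module B = Bounds (bounds cotree-full)

    N≡ : N ≡ B.c + order
    N≡ = trans (Φ[1]≡count G) (trans B.count≡ (cong (B.c +_) ∣full∣≡order))
    T≡ : T ≡ B.s + order
    T≡ = trans (Φ′[1]≡size G) (trans B.size≡ (cong (B.s +_) ∣full∣≡order))

    N+N̅≡ : N + N̅ ≡ Σ⁺ (full {order}) (λ _ → 1)
    N+N̅≡ = trans (cong (_+ N̅) (Φ[1]≡count G)) (weight-not (connected G) _ full)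

    2[T+T̅]≡ : 2 * (T + T̅) ≡ order * suc (N + N̅)
    2[T+T̅]≡ = begin
      2 * (T + T̅)              ≡⟨ cong (λ k → 2 * (k + T̅)) (Φ′[1]≡size G) ⟩
      2 * (size (connected G) full + T̅) ≡⟨ cong (2 *_) (weight-not (connected G) _ full) ⟩
      2 * Σ⁺ (full {order}) ∣_∣ ≡⟨ 2*Σ⁺-∣∣ (full {order}) ⟩
      ∣ full {order} ∣ * suc (Σ⁺ (full {order}) (λ _ → 1))
        ≡⟨ cong₂ (λ k l → k * suc l) ∣full∣≡order (sym N+N̅≡) ⟩
      order * suc (N + N̅)      ∎
      where open ≡-Reasoning

    2T̅< : 2 * T̅ ℕ.< order * N̅ + order
    2T̅< = subst (λ n → 2 * T̅ ℕ.< n * N̅ + n) ∣full∣≡order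
      (strict-bound (cong not full-connected) (Cotree-not cotree-full))

  -- Over all nonempty sets, twice the total size is `order * suc (N + N̅)`. The disconnected sets
  -- account for less than `order * N̅ + order` of it.
  lower : order * N ℕ.< T * 2
  lower = +-cancelʳ-< (order * N̅ + order) (order * N) (T * 2) (begin-strict
    order * N + (order * N̅ + order)  ≡⟨ rearrange order N N̅ ⟩
    order * suc (N + N̅)              ≡⟨ 2[T+T̅]≡ ⟨
    2 * (T + T̅)                      ≡⟨ distrib T T̅ ⟩
    T * 2 + 2 * T̅                    <⟨ +-monoʳ-< (T * 2) 2T̅< ⟩
    T * 2 + (order * N̅ + order)      ∎)
    where
    open ≤-Reasoning
    rearrange : ∀ n a b → n * a + (n * b + n) ≡ n * suc (a + b)
    rearrange = solve-∀
    distrib : ∀ a b → 2 * (a + b) ≡ a * 2 + 2 * b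
    distrib = solve-∀

  -- With n the order, this is `bound₁` with n² added to both sides, which restores the singletons.
  -- The gap (n - 1)² vanishes only for n = 1 and so settles the case of equality.
  upper-gap : T * 2 + ℕ.pred order * ℕ.pred order ℕ.≤ suc order * N
  upper-gap rewrite N≡ | T≡ = with-order order order-nonZero
    (subst (λ n → suc (2 * B.s) ℕ.≤ suc n * B.c + n) ∣full∣≡order B.bound₁)
    where
    open ≤-Reasoning
    with-order : ∀ n → NonZero n → suc (2 * B.s) ℕ.≤ suc n * B.c + n →
                 (B.s + n) * 2 + ℕ.pred n * ℕ.pred n ℕ.≤ suc n * (B.c + n)
    with-order n@(suc k) _ bound = begin
      (B.s + n) * 2 + k * k              ≡⟨ collect B.s k ⟩
      suc (2 * B.s) + (k * k + 2 * k + 1) ≤⟨ +-monoˡ-≤ _ bound ⟩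
      suc n * B.c + n + (k * k + 2 * k + 1) ≡⟨ expand B.c k ⟩
      suc n * (B.c + n)                  ∎
      where
      collect : ∀ s k → (s + suc k) * 2 + k * k ≡ suc (2 * s) + (k * k + 2 * k + 1)
      collect = solve-∀
      expand : ∀ c k → (2 + k) * c + suc k + (k * k + 2 * k + 1) ≡ (2 + k) * (c + suc k)
      expand = solve-∀

  upper : T * 2 ℕ.≤ suc order * N
  upper = ≤-trans (m≤m+n (T * 2) _) upper-gap

  equality⇒order≡1 : T * 2 ≡ suc order * N → order ≡ 1
  equality⇒order≡1 eq = pred²≡0⇒≡1 order order-nonZero
    (+-cancelˡ-≤ (T * 2) _ 0 (≤-trans upper-gap
      (≤-reflexive (trans (sym eq) (sym (+-identityʳ _))))))
    where
    pred²≡0⇒≡1 : ∀ n → NonZero n → ℕ.pred n * ℕ.pred n ℕ.≤ 0 → n ≡ 1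
    pred²≡0⇒≡1 (suc zero) _ _ = refl

  -- A single vertex has one nonempty subset, of size 1, so `N + N̅` and `T + T̅` are 1, while `N`
  -- and `T` are at least the order.
  order≡1⇒equality : order ≡ 1 → T * 2 ≡ suc order * N
  order≡1⇒equality order≡1 = trans (cong (_* 2) T≡1) (sym (cong₂ (λ n k → suc n * k) order≡1 N≡1))
    where
    N+N̅≡1 : N + N̅ ≡ 1
    N+N̅≡1 = trans N+N̅≡ (suc-injective
      (trans (suc-Σ⁺-one (full {order})) (cong (2 ^_) (trans ∣full∣≡order order≡1))))
    T+T̅≡1 : T + T̅ ≡ 1
    T+T̅≡1 = *-cancelˡ-≡ _ _ 2 (trans 2[T+T̅]≡ (cong₂ (λ n k → n * suc k) order≡1 N+N̅≡1))
    ≡1 : ∀ m k {l} → m ≡ k + order → m + l ≡ 1 → m ≡ 1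
    ≡1 m k {l} m≡ m+l≡1 = ≤-antisym (≤-trans (m≤m+n m l) (≤-reflexive m+l≡1))
      (≤-trans (≤-reflexive (sym order≡1)) (≤-trans (m≤n+m order k) (≤-reflexive (sym m≡))))
    N≡1 : N ≡ 1
    N≡1 = ≡1 N B.c N≡ N+N̅≡1
    T≡1 : T ≡ 1
    T≡1 = ≡1 T B.s T≡ T+T̅≡1

-- Rational bounds and the limit

open import Data.Integer.Base using (+_; -[1+_])
open Graph using (order; order-nonZero)

toℚᵘ-/ : ∀ i d-1 → toℚᵘ (i / suc d-1) ℚᵘ.≃ mkℚᵘ i d-1
toℚᵘ-/ i d-1 = ℚ.toℚᵘ-fromℚᵘ (mkℚᵘ i d-1)

/-mono-< : ∀ p m q d .{{_ : NonZero m}} .{{_ : NonZero d}} →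
           p * d ℕ.< q * m → + p / m < + q / d
/-mono-< p m@(suc _) q d@(suc _) pd<qm = ℚ.toℚᵘ-cancel-<
  (ℚᵘ.<-respˡ-≃ (ℚᵘ.≃-sym (toℚᵘ-/ (+ p) _)) (ℚᵘ.<-respʳ-≃ (ℚᵘ.≃-sym (toℚᵘ-/ (+ q) _))
    (ℚᵘ.*<* (subst₂ ℤ._<_ (ℤ.pos-* p d) (ℤ.pos-* q m) (ℤ.+<+ pd<qm)))))

/-mono-≤ : ∀ p m q d .{{_ : NonZero m}} .{{_ : NonZero d}} →
           p * d ℕ.≤ q * m → + p / m ≤ + q / d
/-mono-≤ p m@(suc _) q d@(suc _) pd≤qm = ℚ.toℚᵘ-cancel-≤
  (ℚᵘ.≤-respˡ-≃ (ℚᵘ.≃-sym (toℚᵘ-/ (+ p) _)) (ℚᵘ.≤-respʳ-≃ (ℚᵘ.≃-sym (toℚᵘ-/ (+ q) _))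
    (ℚᵘ.*≤* (subst₂ ℤ._≤_ (ℤ.pos-* p d) (ℤ.pos-* q m) (ℤ.+≤+ pd≤qm)))))

/-injective : ∀ p m q d .{{_ : NonZero m}} .{{_ : NonZero d}} →
              + p / m ≡ + q / d → p * d ≡ q * m
/-injective p m@(suc _) q d@(suc _) eq
  with *≡* pd≡qm ← ℚ.fromℚᵘ-injective {mkℚᵘ (+ p) _} {mkℚᵘ (+ q) _} eq =
  ℤ.+-injective (trans (ℤ.pos-* p d) (trans pd≡qm (sym (ℤ.pos-* q m))))

/-≡ : ∀ p m q d .{{_ : NonZero m}} .{{_ : NonZero d}} →
      p * d ≡ q * m → + p / m ≡ + q / d
/-≡ p m q d eq = ℚ.≤-antisym (/-mono-≤ p m q d (≤-reflexive eq))
                             (/-mono-≤ q d p m (≤-reflexive (sym eq)))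

/-*-/ : ∀ p m q d .{{_ : NonZero m}} .{{_ : NonZero d}} .{{_ : NonZero (m * d)}} →
        (+ p / m) ℚ.* (+ q / d) ≡ + (p * q) / (m * d)
/-*-/ p m@(suc m-1) q d@(suc d-1) = ℚ.toℚᵘ-injective (begin
  toℚᵘ ((+ p / m) ℚ.* (+ q / d))      ≈⟨ ℚ.toℚᵘ-homo-* (+ p / m) (+ q / d) ⟩
  toℚᵘ (+ p / m) ℚᵘ.* toℚᵘ (+ q / d)  ≈⟨ ℚᵘ.*-cong (toℚᵘ-/ (+ p) m-1) (toℚᵘ-/ (+ q) d-1) ⟩
  mkℚᵘ (+ p ℤ.* + q) _                ≡⟨ cong (λ i → mkℚᵘ i _) (ℤ.pos-* p q) ⟨
  mkℚᵘ (+ (p * q)) _                  ≈⟨ toℚᵘ-/ (+ (p * q)) _ ⟨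
  toℚᵘ (+ (p * q) / (m * d))          ∎)
  where open import Relation.Binary.Reasoning.Setoid ℚᵘ.≃-setoid

suc-/2 : ∀ n → + suc n / 2 ≡ + n / 2 ℚ.+ ½
suc-/2 n = ℚ.toℚᵘ-injective (begin
  toℚᵘ (+ suc n / 2)  ≈⟨ toℚᵘ-/ (+ suc n) 1 ⟩
  mkℚᵘ (+ suc n) 1    ≈⟨ *≡* (trans (sym (ℤ.pos-* (suc n) 4))
                                   (trans (cong +_ (identity n)) (trans (ℤ.pos-* (n * 2 + 2) 2)
                                     (cong (λ i → (i ℤ.+ + 2) ℤ.* + 2) (ℤ.pos-* n 2))))) ⟩
  mkℚᵘ (+ n) 1 ℚᵘ.+ toℚᵘ ½    ≈⟨ ℚᵘ.+-congˡ (toℚᵘ ½) (toℚᵘ-/ (+ n) 1) ⟨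
  toℚᵘ (+ n / 2) ℚᵘ.+ toℚᵘ ½  ≈⟨ ℚ.toℚᵘ-homo-+ (+ n / 2) ½ ⟨
  toℚᵘ (+ n / 2 ℚ.+ ½)        ∎)
  where
  open import Relation.Binary.Reasoning.Setoid ℚᵘ.≃-setoid
  identity : ∀ n → suc n * 4 ≡ (n * 2 + 2) * 2
  identity = solve-∀

÷-* : ∀ p q .{{_ : ℚ.NonZero q}} → (p ℚ.÷ q) ℚ.* q ≡ p
÷-* p q = trans (ℚ.*-assoc p (1/ q) q) (trans (cong (p ℚ.*_) (ℚ.*-inverseˡ q)) (ℚ.*-identityʳ p))

M-lower : ∀ G → Connected G → Cograph G → + order G / 2 < M G
M-lower G conn cograph =
  /-mono-< (order G) 2 (eval (deriv (Φ G)) 1) (eval (Φ G) 1) {{_}} {{Φ[1]-nonZero G}}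
    (MeanBounds.lower G conn cograph)

M-upper : ∀ G → Connected G → Cograph G → M G ≤ + suc (order G) / 2
M-upper G conn cograph =
  /-mono-≤ (eval (deriv (Φ G)) 1) (eval (Φ G) 1) (suc (order G)) 2 {{Φ[1]-nonZero G}}
    (MeanBounds.upper G conn cograph)

M-equality : ∀ G → Connected G → Cograph G → M G ≡ + suc (order G) / 2 ⇔ order G ≡ 1
M-equality G conn cograph = mk⇔
  (λ eq → equality⇒order≡1 (/-injective T N (suc (order G)) 2 {{Φ[1]-nonZero G}} eq))
  (λ eq → /-≡ T N (suc (order G)) 2 {{Φ[1]-nonZero G}} (order≡1⇒equality eq))
  where
  open MeanBounds G conn cograph
  T = eval (deriv (Φ G)) 1
  N = eval (Φ G) 1

-- A positive rational is at least the reciprocal of its denominator, so the product is at least 1.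
½<ε*n : ∀ ε n → 0ℚ < ε → ↧ₙ ε ℕ.≤ n → ½ < ε ℚ.* (+ n / 1)
½<ε*n (mkℚ (+ zero)     _     _) n (*<* (ℤ.+<+ ())) _
½<ε*n (mkℚ (-[1+ _ ])  _     _) n (*<* ())         _
½<ε*n ε@(mkℚ (+ suc p) d-1 _) n _                d≤n =
  subst (λ x → ½ < x ℚ.* (+ n / 1)) (ℚ.↥p/↧p≡p ε)
    (subst (½ <_) (sym (/-*-/ (suc p) d n 1)) (/-mono-< 1 2 (suc p * n) (d * 1) (begin-strict
      1 * (d * 1)    ≡⟨ trans (*-identityˡ _) (*-identityʳ d) ⟩
      d              ≤⟨ d≤n ⟩
      n              <⟨ m<m*n n 2 {{ℕ.>-nonZero (≤-trans (s≤s z≤n) d≤n)}} (s≤s (s≤s z≤n)) ⟩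
      n * 2          ≤⟨ *-monoˡ-≤ 2 (m≤m+n n (p * n)) ⟩
      suc p * n * 2  ∎)))
  where
  open ≤-Reasoning
  d = suc d-1

density-near-½ : ∀ G → Connected G → Cograph G → ∀ ε → 0ℚ < ε → ↧ₙ ε ℕ.≤ order G →
                 ℚ.∣ density G ℚ.- ½ ∣ < ε
density-near-½ G conn cograph ε 0<ε d≤n = subst (_< ε) (sym (ℚ.0≤p⇒∣p∣≡p 0≤δ)) δ<ε
  where
  n = + order G / 1
  instance
    n-positive : Positive n
    n-positive = ℚ.normalize-pos (order G) 1 {{_}} {{order-nonZero G}}
    n-nonNegative : ℚ.NonNegative n
    n-nonNegative = ℚ.pos⇒nonNeg n
    n-nonZero : ℚ.NonZero n
    n-nonZero = ℚ.pos⇒nonZero n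
  density*n : density G ℚ.* n ≡ M G
  density*n = ÷-* (M G) n
  ½*n : ½ ℚ.* n ≡ + order G / 2
  ½*n = trans (/-*-/ 1 2 (order G) 1) (cong (λ k → + k / 2) (*-identityˡ (order G)))
  ½<density : ½ < density G
  ½<density = ℚ.*-cancelʳ-<-nonNeg n
    (subst₂ _<_ (sym ½*n) (sym density*n) (M-lower G conn cograph))
  density<½+ε : density G < ½ ℚ.+ ε
  density<½+ε = ℚ.*-cancelʳ-<-nonNeg n (begin-strict
    density G ℚ.* n            ≡⟨ density*n ⟩
    M G                        ≤⟨ M-upper G conn cograph ⟩
    + suc (order G) / 2        ≡⟨ suc-/2 (order G) ⟩
    + order G / 2 ℚ.+ ½        <⟨ ℚ.+-monoʳ-< (+ order G / 2) (½<ε*n ε (order G) 0<ε d≤n) ⟩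
    + order G / 2 ℚ.+ ε ℚ.* n  ≡⟨ cong (ℚ._+ ε ℚ.* n) ½*n ⟨
    ½ ℚ.* n ℚ.+ ε ℚ.* n        ≡⟨ ℚ.*-distribʳ-+ n ½ ε ⟨
    (½ ℚ.+ ε) ℚ.* n            ∎)
    where open ℚ.≤-Reasoning
  0≤δ : 0ℚ ≤ density G ℚ.- ½
  0≤δ = subst (_≤ density G ℚ.- ½) (ℚ.+-inverseʳ ½) (ℚ.+-monoˡ-≤ (ℚ.- ½) (ℚ.<⇒≤ ½<density))
  δ<ε : density G ℚ.- ½ < ε
  δ<ε = subst (density G ℚ.- ½ <_) cancel (ℚ.+-monoˡ-< (ℚ.- ½) density<½+ε)
    where
    cancel : ½ ℚ.+ ε ℚ.- ½ ≡ ε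
    cancel = trans (cong (ℚ._- ½) (ℚ.+-comm ½ ε)) (trans (ℚ.+-assoc ε ½ (ℚ.- ½)) (ℚ.+-identityʳ ε))

-- Finitely many graphs of each order

-- Codes are adjacency matrices, one bit per ordered pair of vertices.
Code : ℕ → Set
Code m = Fin ((2 ^ m) ^ m)

-- The equation on the order lets all the graphs of a sequence be compared with codes of one fixed
-- size `m`.
HasCode : ∀ m → Code m → Graph → Set
HasCode m k G = Σ[ eq ∈ order G ≡ m ] (∀ u v →
  Inverse.from 2↔Bool (adjacent G (subst Fin (sym eq) u) (subst Fin (sym eq) v))
    ≡ finToFun (finToFun k u) v)

code : ∀ G → Σ[ k ∈ Code (order G) ] HasCode (order G) k G
code G = funToFin row , refl , λ u v → sym
    (trans (cong (λ r → finToFun r v) (finToFun-funToFin row u))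
           (finToFun-funToFin (λ w → Inverse.from 2↔Bool (adjacent G u w)) v))
  where
  row : Fin (order G) → Fin (2 ^ order G)
  row u = funToFin λ w → Inverse.from 2↔Bool (adjacent G u w)

-- Two graphs with equal adjacency matrices are isomorphic by the identity map.
same-code⇒≅ : ∀ m (k : Code m) G H → HasCode m k G → HasCode m k H → G ≅ H
same-code⇒≅ m k G@record{ order = _ } H@record{ order = _ } (refl , G-code) (refl , H-code) =
  ↔-id _ , λ u v → mk⇔
  (λ u~v → adjacent-true H (trans (sym (same u v)) (dec-true (u G.~? v) u~v)))
  (λ u~v → adjacent-true G (trans (same u v) (dec-true (u H.~? v) u~v)))
  where
  module G = Graph G
  module H = Graph H
  from-injective : ∀ {p q} → Inverse.from 2↔Bool p ≡ Inverse.from 2↔Bool q → p ≡ q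
  from-injective {p} {q} eq = trans (sym (Inverse.strictlyInverseˡ 2↔Bool p))
    (trans (cong (Inverse.to 2↔Bool) eq) (Inverse.strictlyInverseˡ 2↔Bool q))
  same : ∀ u v → adjacent G u v ≡ adjacent H u v
  same u v = from-injective (trans (G-code u v) (sym (H-code u v)))

-- Each of finitely many predicates holds at one index at most. Excluded middle decides whether
-- there is such an index, and `I` is chosen beyond all of them.
eventually-none : ExcludedMiddle 0ℓ → ∀ K (R : Fin K → ℕ → Set) →
  (∀ k {i j} → R k i → R k j → i ≡ j) → ∃[ I ] (∀ i → I ℕ.≤ i → ∀ k → ¬ R k i)
eventually-none em zero    R unique = 0 , λ _ _ ()
eventually-none em (suc K) R unique
  with eventually-none em K (R ∘ suc) (unique ∘ suc) | em {∃[ i ] R zero i}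
... | I , none | no ∄i = I , λ { i I≤i zero r → ∄i (i , r) ; i I≤i (suc k) → none i I≤i k }
... | I , none | yes (i₀ , r₀) = suc i₀ ⊔ I , λ
  { i I≤i zero r    → <-irrefl (unique zero r₀ r) (≤-trans (m≤m⊔n (suc i₀) I) I≤i)
  ; i I≤i (suc k) r → none i (≤-trans (m≤n⊔m (suc i₀) I) I≤i) k r }

-- By induction on `N`: the graphs are pairwise non-isomorphic, so each of the finitely many codes
-- for order `N` occurs at most once, and from some index on that order is no longer attained.
orders-tend-to-∞ : ExcludedMiddle 0ℓ → ∀ (G : ℕ → Graph) → (∀ i j → i ≢ j → ¬ (G i ≅ G j)) →
  ∀ N → ∃[ I ] (∀ i → I ℕ.≤ i → N ℕ.≤ order (G i))
orders-tend-to-∞ em G distinct zero    = 0 , λ _ _ → z≤n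
orders-tend-to-∞ em G distinct (suc N)
  with orders-tend-to-∞ em G distinct N
     | eventually-none em _ (λ (k : Code N) i → HasCode N k (G i)) unique
  where
  unique : ∀ (k : Code N) {i j} → HasCode N k (G i) → HasCode N k (G j) → i ≡ j
  unique k {i} {j} Gi Gj with i ℕ.≟ j
  ... | yes i≡j = i≡j
  ... | no  i≢j = contradiction (same-code⇒≅ N k (G i) (G j) Gi Gj) (distinct i j i≢j)
... | I , N≤ | J , none = I ⊔ J , λ i I⊔J≤i → ≤∧≢⇒< (N≤ i (≤-trans (m≤m⊔n I J) I⊔J≤i))
  λ N≡order → no-code i (≤-trans (m≤n⊔m I J) I⊔J≤i) (sym N≡order)
  where
  no-code : ∀ i → J ℕ.≤ i → ¬ (order (G i) ≡ N)
  no-code i J≤i refl = none i J≤i (proj₁ (code (G i))) (proj₂ (code (G i)))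

mainTheorem5 : (∀ (G : Graph) → Connected G → Cograph G →
    (+ order G / 2 < M G) ×
    (M G ≤ + suc (order G) / 2) ×
    (M G ≡ + suc (order G) / 2 ⇔ order G ≡ 1))
    ×
    (ExcludedMiddle 0ℓ →
    ∀ (G : ℕ → Graph) →
    (∀ i → Connected (G i)) →
    (∀ i → Cograph (G i)) →
    (∀ i j → i ≢ j → ¬ (G i ≅ G j)) →
    (λ i → density (G i)) ⟶ ½)
mainTheorem5 =
  (λ G conn cograph → M-lower G conn cograph , M-upper G conn cograph , M-equality G conn cograph) ,
  λ em G conn cograph distinct ε 0<ε →
    let I , large = orders-tend-to-∞ em G distinct (↧ₙ ε)
    in I , λ i I≤i → density-near-½ (G i) (conn i) (cograph i) ε 0<ε (large i I≤i)
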